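{- Let $n$ be a positive odd integer. Then, modulo $(1-aq^n)(a-q^n)$, $$ \sum_{k=0}^{n-1}\frac{(aq;q^2)_k\,(q/a;q^2)_k}{(q^2;q^2)_k^2}\, x^k \equiv (-1)^{(n-1)/2}q^{(1-n^2)/4} \sum_{k=0}^{n-1}\frac{(aq;q^2)_k\,(q/a;q^2)_k}{(q^2;q^2)_k^2}\, q^{2k}\,(x;q^2)_k. $$
   Context: $a,q,x$ are indeterminates. The $q$-shifted factorial is $(y;q)_0=1$ and $(y;q)_m=(1-y)(1-yq)\cdots(1-yq^{m-1})$ for $m\geqslant1$. For rational functions $A,B$ and a polynomial $P$, $A\equiv B\pmod P$ means $A-B=P\cdot C/D$ for polynomials $C,D$ with $D$ coprime to $P$. -}

module Defs where

open import Algebra.Bundles using (CommutativeRing; RawRing)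
open import Algebra.Consequences.Setoid using (comm∧idˡ⇒id)
open import Algebra.Definitions.RawSemiring using (Coprime)
open import Algebra.Structures using (IsCommutativeRing)
open import Data.Fin.Base using (toℕ)
open import Data.Integer.Base as ℤ using (ℤ; +_; -[1+_])
open import Data.List.Base using (List; []; _∷_; map)
open import Data.Nat.Base as ℕ using (ℕ; zero; suc)
open import Data.Product.Base using (Σ-syntax; ∃-syntax; _×_; _,_)
open import Data.Sum.Base using (_⊎_; inj₁; inj₂; [_,_]′)
open import Level using (Level; 0ℓ; _⊔_)
open import Relation.Binary.Bundles using (Setoid)
open import Relation.Binary.Structures using (IsEquivalence)
open import Relation.Nullary.Decidable.Core using (Dec; yes; no)
import Algebra.Definitions.RawSemiring as RawSemiringDefs
import Algebra.Properties.CommutativeSemigroup as CommutativeSemigroupProperties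
import Algebra.Properties.Ring as RingProperties
import Data.Integer.Properties as ℤₚ
import Relation.Binary.Reasoning.Setoid as SetoidReasoning

private
  variable
    c ℓ : Level

-- Integral domains with decidable vanishing; the latter makes the inverse of a
-- fraction a total function.
record IntegralDomain (c ℓ : Level) : Set (Level.suc (c ⊔ ℓ)) where
  field
    commutativeRing : CommutativeRing c ℓ
  open CommutativeRing commutativeRing public
  field
    1≉0       : 1# ≉ 0#
    ≈0?       : ∀ x → Dec (x ≈ 0#)
    *-nonZero : ∀ {x y} → x ≉ 0# → y ≉ 0# → x * y ≉ 0#

-- Univariate polynomials: lists of coefficients, constant term first, identified
-- when they agree up to trailing zeros.
module Polynomial (R : CommutativeRing c ℓ) where
  open CommutativeRing R renaming (Carrier to A)
  open RingProperties ring using (-0#≈0#)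
  open CommutativeSemigroupProperties +-commutativeSemigroup using (interchange)

  Poly : Set c
  Poly = List A

  coeff : Poly → ℕ → A
  coeff []      _       = 0#
  coeff (x ∷ p) zero    = x
  coeff (x ∷ p) (suc i) = coeff p i

  infix 4 _≈ₚ_
  record _≈ₚ_ (p r : Poly) : Set ℓ where
    constructor coeffs
    field at : ∀ i → coeff p i ≈ coeff r i
  open _≈ₚ_ public

  infixl 6 _+ₚ_
  _+ₚ_ : Poly → Poly → Poly
  []      +ₚ r       = r
  (x ∷ p) +ₚ []      = x ∷ p
  (x ∷ p) +ₚ (y ∷ r) = (x + y) ∷ (p +ₚ r)

  infixr 7 _·_
  _·_ : A → Poly → Poly
  x · p = map (x *_) p

  infixl 7 _*ₚ_
  _*ₚ_ : Poly → Poly → Poly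
  []      *ₚ r = []
  (x ∷ p) *ₚ r = x · r +ₚ (0# ∷ p *ₚ r)

  -ₚ_ : Poly → Poly
  -ₚ p = map -_ p

  0ₚ 1ₚ X : Poly
  0ₚ = []
  1ₚ = 1# ∷ []
  X  = 0# ∷ 1# ∷ []

  constant : A → Poly
  constant x = x ∷ []

  coeff-+ : ∀ p r i → coeff (p +ₚ r) i ≈ coeff p i + coeff r i
  coeff-+ []      r       i       = sym (+-identityˡ _)
  coeff-+ (x ∷ p) []      i       = sym (+-identityʳ _)
  coeff-+ (x ∷ p) (y ∷ r) zero    = refl
  coeff-+ (x ∷ p) (y ∷ r) (suc i) = coeff-+ p r i

  coeff-· : ∀ x p i → coeff (x · p) i ≈ x * coeff p i
  coeff-· x []      i       = sym (zeroʳ x)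
  coeff-· x (y ∷ p) zero    = refl
  coeff-· x (y ∷ p) (suc i) = coeff-· x p i

  coeff-neg : ∀ p i → coeff (-ₚ p) i ≈ - coeff p i
  coeff-neg []      i       = sym -0#≈0#
  coeff-neg (y ∷ p) zero    = refl
  coeff-neg (y ∷ p) (suc i) = coeff-neg p i

  ≈ₚ-isEquivalence : IsEquivalence _≈ₚ_
  ≈ₚ-isEquivalence = record
    { refl  = coeffs λ _ → refl
    ; sym   = λ e → coeffs λ i → sym (at e i)
    ; trans = λ e f → coeffs λ i → trans (at e i) (at f i)
    }

  ≈ₚ-setoid : Setoid c ℓ
  ≈ₚ-setoid = record { isEquivalence = ≈ₚ-isEquivalence }

  open IsEquivalence ≈ₚ-isEquivalence public using ()
    renaming (refl to ≈ₚ-refl; sym to ≈ₚ-sym; trans to ≈ₚ-trans)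

  ∷-cong : ∀ {x y p r} → x ≈ y → p ≈ₚ r → (x ∷ p) ≈ₚ (y ∷ r)
  ∷-cong e f = coeffs λ { zero → e ; (suc i) → at f i }

  0∷0 : ∀ {x p} → x ≈ 0# → p ≈ₚ 0ₚ → (x ∷ p) ≈ₚ 0ₚ
  0∷0 e f = coeffs λ { zero → e ; (suc i) → at f i }

  tail-cong : ∀ {x y p r} → (x ∷ p) ≈ₚ (y ∷ r) → p ≈ₚ r
  tail-cong e = coeffs λ i → at e (suc i)

  tail-0 : ∀ {x p} → (x ∷ p) ≈ₚ 0ₚ → p ≈ₚ 0ₚ
  tail-0 e = coeffs λ i → at e (suc i)

  +ₚ-cong : ∀ {p p′ r r′} → p ≈ₚ p′ → r ≈ₚ r′ → p +ₚ r ≈ₚ p′ +ₚ r′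
  +ₚ-cong {p} {p′} {r} {r′} e f = coeffs λ i →
    trans (coeff-+ p r i) (trans (+-cong (at e i) (at f i)) (sym (coeff-+ p′ r′ i)))

  +ₚ-assoc : ∀ p r s → (p +ₚ r) +ₚ s ≈ₚ p +ₚ (r +ₚ s)
  +ₚ-assoc p r s = coeffs λ i → begin
    coeff ((p +ₚ r) +ₚ s) i             ≈⟨ coeff-+ (p +ₚ r) s i ⟩
    coeff (p +ₚ r) i + coeff s i        ≈⟨ +-congʳ (coeff-+ p r i) ⟩
    coeff p i + coeff r i + coeff s i   ≈⟨ +-assoc _ _ _ ⟩
    coeff p i + (coeff r i + coeff s i) ≈⟨ +-congˡ (coeff-+ r s i) ⟨
    coeff p i + coeff (r +ₚ s) i        ≈⟨ coeff-+ p (r +ₚ s) i ⟨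
    coeff (p +ₚ (r +ₚ s)) i             ∎
    where open SetoidReasoning setoid

  +ₚ-comm : ∀ p r → p +ₚ r ≈ₚ r +ₚ p
  +ₚ-comm p r = coeffs λ i →
    trans (coeff-+ p r i) (trans (+-comm _ _) (sym (coeff-+ r p i)))

  +ₚ-identityʳ : ∀ p → p +ₚ 0ₚ ≈ₚ p
  +ₚ-identityʳ p = +ₚ-comm p 0ₚ

  -ₚ-cong : ∀ {p r} → p ≈ₚ r → -ₚ p ≈ₚ -ₚ r
  -ₚ-cong {p} {r} e = coeffs λ i →
    trans (coeff-neg p i) (trans (-‿cong (at e i)) (sym (coeff-neg r i)))

  -ₚ-inverseʳ : ∀ p → p +ₚ (-ₚ p) ≈ₚ 0ₚ
  -ₚ-inverseʳ p = coeffs λ i →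
    trans (coeff-+ p (-ₚ p) i) (trans (+-congˡ (coeff-neg p i)) (-‿inverseʳ _))

  -ₚ-inverseˡ : ∀ p → (-ₚ p) +ₚ p ≈ₚ 0ₚ
  -ₚ-inverseˡ p = ≈ₚ-trans (+ₚ-comm (-ₚ p) p) (-ₚ-inverseʳ p)

  +ₚ-interchange : ∀ p r s t → (p +ₚ r) +ₚ (s +ₚ t) ≈ₚ (p +ₚ s) +ₚ (r +ₚ t)
  +ₚ-interchange p r s t = coeffs λ i → begin
    coeff ((p +ₚ r) +ₚ (s +ₚ t)) i                      ≈⟨ expand p r s t i ⟩
    (coeff p i + coeff r i) + (coeff s i + coeff t i)   ≈⟨ interchange _ _ _ _ ⟩
    (coeff p i + coeff s i) + (coeff r i + coeff t i)   ≈⟨ expand p s r t i ⟨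
    coeff ((p +ₚ s) +ₚ (r +ₚ t)) i                      ∎
    where
    open SetoidReasoning setoid
    expand : ∀ p r s t i → coeff ((p +ₚ r) +ₚ (s +ₚ t)) i
                         ≈ (coeff p i + coeff r i) + (coeff s i + coeff t i)
    expand p r s t i =
      trans (coeff-+ (p +ₚ r) (s +ₚ t) i) (+-cong (coeff-+ p r i) (coeff-+ s t i))

  +ₚ-swap : ∀ p r s → p +ₚ (r +ₚ s) ≈ₚ r +ₚ (p +ₚ s)
  +ₚ-swap p r s = ≈ₚ-trans (≈ₚ-sym (+ₚ-assoc p r s))
    (≈ₚ-trans (+ₚ-cong (+ₚ-comm p r) ≈ₚ-refl) (+ₚ-assoc r p s))

  ·-cong : ∀ {x y p r} → x ≈ y → p ≈ₚ r → x · p ≈ₚ y · r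
  ·-cong {x} {y} {p} {r} e f = coeffs λ i →
    trans (coeff-· x p i) (trans (*-cong e (at f i)) (sym (coeff-· y r i)))

  0·p≈0 : ∀ p → 0# · p ≈ₚ 0ₚ
  0·p≈0 p = coeffs λ i → trans (coeff-· 0# p i) (zeroˡ _)

  1·p≈p : ∀ p → 1# · p ≈ₚ p
  1·p≈p p = coeffs λ i → trans (coeff-· 1# p i) (*-identityˡ _)

  ·-distribˡ : ∀ x p r → x · (p +ₚ r) ≈ₚ x · p +ₚ x · r
  ·-distribˡ x p r = coeffs λ i → begin
    coeff (x · (p +ₚ r)) i              ≈⟨ coeff-· x (p +ₚ r) i ⟩
    x * coeff (p +ₚ r) i                ≈⟨ *-congˡ (coeff-+ p r i) ⟩
    x * (coeff p i + coeff r i)         ≈⟨ distribˡ _ _ _ ⟩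
    x * coeff p i + x * coeff r i       ≈⟨ +-cong (coeff-· x p i) (coeff-· x r i) ⟨
    coeff (x · p) i + coeff (x · r) i   ≈⟨ coeff-+ (x · p) (x · r) i ⟨
    coeff (x · p +ₚ x · r) i            ∎
    where open SetoidReasoning setoid

  ·-distribʳ : ∀ x y p → (x + y) · p ≈ₚ x · p +ₚ y · p
  ·-distribʳ x y p = coeffs λ i → begin
    coeff ((x + y) · p) i               ≈⟨ coeff-· (x + y) p i ⟩
    (x + y) * coeff p i                 ≈⟨ distribʳ _ _ _ ⟩
    x * coeff p i + y * coeff p i       ≈⟨ +-cong (coeff-· x p i) (coeff-· y p i) ⟨
    coeff (x · p) i + coeff (y · p) i   ≈⟨ coeff-+ (x · p) (y · p) i ⟨
    coeff (x · p +ₚ y · p) i            ∎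
    where open SetoidReasoning setoid

  ·-assoc : ∀ x y p → (x * y) · p ≈ₚ x · (y · p)
  ·-assoc x y p = coeffs λ i → trans (coeff-· (x * y) p i) (trans (*-assoc _ _ _)
    (sym (trans (coeff-· x (y · p) i) (*-congˡ (coeff-· y p i)))))

  private module ≈ₚ-Reasoning = SetoidReasoning ≈ₚ-setoid

  *ₚ-zeroʳ : ∀ p → p *ₚ 0ₚ ≈ₚ 0ₚ
  *ₚ-zeroʳ []      = ≈ₚ-refl
  *ₚ-zeroʳ (x ∷ p) = 0∷0 refl (*ₚ-zeroʳ p)

  ≈0⇒*ₚ≈0 : ∀ p r → p ≈ₚ 0ₚ → p *ₚ r ≈ₚ 0ₚ
  ≈0⇒*ₚ≈0 []      r e = ≈ₚ-refl
  ≈0⇒*ₚ≈0 (x ∷ p) r e = +ₚ-cong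
    (≈ₚ-trans (·-cong (at e 0) (≈ₚ-refl {r})) (0·p≈0 r))
    (0∷0 refl (≈0⇒*ₚ≈0 p r (tail-0 e)))

  *ₚ-congʳ : ∀ p p′ r → p ≈ₚ p′ → p *ₚ r ≈ₚ p′ *ₚ r
  *ₚ-congʳ []      p′       r e = ≈ₚ-sym (≈0⇒*ₚ≈0 p′ r (≈ₚ-sym e))
  *ₚ-congʳ (x ∷ p) []       r e = ≈0⇒*ₚ≈0 (x ∷ p) r e
  *ₚ-congʳ (x ∷ p) (y ∷ p′) r e = +ₚ-cong
    (·-cong (at e 0) (≈ₚ-refl {r}))
    (∷-cong refl (*ₚ-congʳ p p′ r (tail-cong e)))

  *ₚ-congˡ : ∀ p {r r′} → r ≈ₚ r′ → p *ₚ r ≈ₚ p *ₚ r′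
  *ₚ-congˡ []      e = ≈ₚ-refl
  *ₚ-congˡ (x ∷ p) e = +ₚ-cong (·-cong refl e) (∷-cong refl (*ₚ-congˡ p e))

  *ₚ-cong : ∀ {p p′ r r′} → p ≈ₚ p′ → r ≈ₚ r′ → p *ₚ r ≈ₚ p′ *ₚ r′
  *ₚ-cong {p} {p′} {r} e f = ≈ₚ-trans (*ₚ-congʳ p p′ r e) (*ₚ-congˡ p′ f)

  0∷-+ₚ : ∀ p r → (0# ∷ (p +ₚ r)) ≈ₚ (0# ∷ p) +ₚ (0# ∷ r)
  0∷-+ₚ p r = ∷-cong (sym (+-identityˡ 0#)) ≈ₚ-refl

  *ₚ-distribˡ : ∀ p r s → p *ₚ (r +ₚ s) ≈ₚ p *ₚ r +ₚ p *ₚ s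
  *ₚ-distribˡ []      r s = ≈ₚ-refl
  *ₚ-distribˡ (x ∷ p) r s = begin
    x · (r +ₚ s) +ₚ (0# ∷ p *ₚ (r +ₚ s))
      ≈⟨ +ₚ-cong (·-distribˡ x r s)
           (≈ₚ-trans (∷-cong refl (*ₚ-distribˡ p r s)) (0∷-+ₚ (p *ₚ r) (p *ₚ s))) ⟩
    (x · r +ₚ x · s) +ₚ ((0# ∷ p *ₚ r) +ₚ (0# ∷ p *ₚ s))
      ≈⟨ +ₚ-interchange (x · r) (x · s) (0# ∷ p *ₚ r) (0# ∷ p *ₚ s) ⟩
    (x · r +ₚ (0# ∷ p *ₚ r)) +ₚ (x · s +ₚ (0# ∷ p *ₚ s)) ∎
    where open ≈ₚ-Reasoning

  *ₚ-∷ : ∀ p y r → p *ₚ (y ∷ r) ≈ₚ y · p +ₚ (0# ∷ p *ₚ r)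
  *ₚ-∷ []      y r = ≈ₚ-sym (0∷0 refl ≈ₚ-refl)
  *ₚ-∷ (x ∷ p) y r = ∷-cong (+-congʳ (*-comm x y)) (begin
    x · r +ₚ p *ₚ (y ∷ r)               ≈⟨ +ₚ-cong (≈ₚ-refl {x · r}) (*ₚ-∷ p y r) ⟩
    x · r +ₚ (y · p +ₚ (0# ∷ p *ₚ r))   ≈⟨ +ₚ-swap (x · r) (y · p) (0# ∷ p *ₚ r) ⟩
    y · p +ₚ (x · r +ₚ (0# ∷ p *ₚ r))   ∎)
    where open ≈ₚ-Reasoning

  *ₚ-comm : ∀ p r → p *ₚ r ≈ₚ r *ₚ p
  *ₚ-comm []      r = ≈ₚ-sym (*ₚ-zeroʳ r)
  *ₚ-comm (x ∷ p) r = begin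
    x · r +ₚ (0# ∷ p *ₚ r) ≈⟨ +ₚ-cong (≈ₚ-refl {x · r}) (∷-cong refl (*ₚ-comm p r)) ⟩
    x · r +ₚ (0# ∷ r *ₚ p) ≈⟨ *ₚ-∷ r x p ⟨
    r *ₚ (x ∷ p)           ∎
    where open ≈ₚ-Reasoning

  *ₚ-distribʳ : ∀ s p r → (p +ₚ r) *ₚ s ≈ₚ p *ₚ s +ₚ r *ₚ s
  *ₚ-distribʳ s p r = ≈ₚ-trans (*ₚ-comm (p +ₚ r) s) (≈ₚ-trans (*ₚ-distribˡ s p r)
    (+ₚ-cong (*ₚ-comm s p) (*ₚ-comm s r)))

  ·-*ₚ : ∀ x p r → (x · p) *ₚ r ≈ₚ x · (p *ₚ r)
  ·-*ₚ x []      r = ≈ₚ-refl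
  ·-*ₚ x (y ∷ p) r = begin
    (x * y) · r +ₚ (0# ∷ (x · p) *ₚ r)
      ≈⟨ +ₚ-cong (·-assoc x y r) (∷-cong (sym (zeroʳ x)) (·-*ₚ x p r)) ⟩
    x · (y · r) +ₚ x · (0# ∷ p *ₚ r)
      ≈⟨ ·-distribˡ x (y · r) (0# ∷ p *ₚ r) ⟨
    x · (y · r +ₚ (0# ∷ p *ₚ r)) ∎
    where open ≈ₚ-Reasoning

  *ₚ-assoc : ∀ p r s → (p *ₚ r) *ₚ s ≈ₚ p *ₚ (r *ₚ s)
  *ₚ-assoc []      r s = ≈ₚ-refl
  *ₚ-assoc (x ∷ p) r s = begin
    (x · r +ₚ (0# ∷ p *ₚ r)) *ₚ s
      ≈⟨ *ₚ-distribʳ s (x · r) (0# ∷ p *ₚ r) ⟩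
    (x · r) *ₚ s +ₚ (0# · s +ₚ (0# ∷ (p *ₚ r) *ₚ s))
      ≈⟨ +ₚ-cong (·-*ₚ x r s) (+ₚ-cong (0·p≈0 s) (∷-cong refl (*ₚ-assoc p r s))) ⟩
    x · (r *ₚ s) +ₚ (0# ∷ p *ₚ (r *ₚ s)) ∎
    where open ≈ₚ-Reasoning

  *ₚ-identityˡ : ∀ p → 1ₚ *ₚ p ≈ₚ p
  *ₚ-identityˡ p = ≈ₚ-trans
    (+ₚ-cong (1·p≈p p) (0∷0 refl ≈ₚ-refl)) (+ₚ-identityʳ p)

  polynomial-isCommutativeRing : IsCommutativeRing _≈ₚ_ _+ₚ_ _*ₚ_ -ₚ_ 0ₚ 1ₚ
  polynomial-isCommutativeRing = record
    { isRing = record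
      { +-isAbelianGroup = record
        { isGroup = record
          { isMonoid = record
            { isSemigroup = record
              { isMagma = record { isEquivalence = ≈ₚ-isEquivalence ; ∙-cong = +ₚ-cong }
              ; assoc   = +ₚ-assoc
              }
            ; identity = (λ _ → ≈ₚ-refl) , +ₚ-identityʳ
            }
          ; inverse = -ₚ-inverseˡ , -ₚ-inverseʳ
          ; ⁻¹-cong = -ₚ-cong
          }
        ; comm = +ₚ-comm
        }
      ; *-cong     = *ₚ-cong
      ; *-assoc    = *ₚ-assoc
      ; *-identity = comm∧idˡ⇒id ≈ₚ-setoid *ₚ-comm *ₚ-identityˡ
      ; distrib    = *ₚ-distribˡ , *ₚ-distribʳ
      }
    ; *-comm = *ₚ-comm
    }

  polynomialRing : CommutativeRing c ℓ
  polynomialRing = record { isCommutativeRing = polynomial-isCommutativeRing }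

module PolynomialDomain (D : IntegralDomain c ℓ) where
  open IntegralDomain D
  open Polynomial commutativeRing public

  ≈ₚ0? : ∀ p → Dec (p ≈ₚ 0ₚ)
  ≈ₚ0? [] = yes ≈ₚ-refl
  ≈ₚ0? (x ∷ p) with ≈0? x | ≈ₚ0? p
  ... | yes e | yes f = yes (0∷0 e f)
  ... | no ne | _     = no λ e → ne (at e 0)
  ... | yes _ | no nf = no λ e → nf (tail-0 e)

  0·+ₚ≈0⇒≈0 : ∀ {x} p r → x ≈ 0# → x · p +ₚ (0# ∷ r) ≈ₚ 0ₚ → r ≈ₚ 0ₚ
  0·+ₚ≈0⇒≈0 p r e f = tail-0 (≈ₚ-trans
    (≈ₚ-sym (+ₚ-cong (≈ₚ-trans (·-cong e (≈ₚ-refl {p})) (0·p≈0 p)) ≈ₚ-refl)) f)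

  NoZeroDivisors : Poly → Poly → Set ℓ
  NoZeroDivisors p r = p *ₚ r ≈ₚ 0ₚ → p ≈ₚ 0ₚ ⊎ r ≈ₚ 0ₚ

  noZeroDivisors-∷ : ∀ x p y r → NoZeroDivisors p (y ∷ r) → NoZeroDivisors (x ∷ p) r →
                     NoZeroDivisors (x ∷ p) (y ∷ r)
  noZeroDivisors-∷ x p y r ih₁ ih₂ e with ≈0? x | ≈0? y
  ... | yes x≈0 | _ =
        [ (λ f → inj₁ (0∷0 x≈0 f)) , inj₂ ]′
        (ih₁ (0·+ₚ≈0⇒≈0 (y ∷ r) (p *ₚ (y ∷ r)) x≈0 e))
  ... | no _ | yes y≈0 =
        [ inj₁ , (λ f → inj₂ (0∷0 y≈0 f)) ]′
        (ih₂ (0·+ₚ≈0⇒≈0 (x ∷ p) ((x ∷ p) *ₚ r) y≈0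
          (≈ₚ-trans (≈ₚ-sym (*ₚ-∷ (x ∷ p) y r)) e)))
  ... | no x≉0 | no y≉0 with () ← *-nonZero x≉0 y≉0 (trans (sym (+-identityʳ _)) (at e 0))

  noZeroDivisors : ∀ p r → NoZeroDivisors p r
  noZeroDivisors []      r       = λ _ → inj₁ ≈ₚ-refl
  noZeroDivisors (x ∷ p) []      = λ _ → inj₂ ≈ₚ-refl
  noZeroDivisors (x ∷ p) (y ∷ r) =
    noZeroDivisors-∷ x p y r (noZeroDivisors p (y ∷ r)) (noZeroDivisors (x ∷ p) r)

  polynomialDomain : IntegralDomain c ℓ
  polynomialDomain = record
    { commutativeRing = polynomialRing
    ; 1≉0             = λ e → 1≉0 (at e 0)
    ; ≈0?             = ≈ₚ0?
    ; *-nonZero       = λ {p} {r} p≉0 r≉0 e → [ p≉0 , r≉0 ]′ (noZeroDivisors p r e)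
    }

module Fractions (D : IntegralDomain c ℓ) where
  private module D = IntegralDomain D

  record Fraction : Set (c ⊔ ℓ) where
    constructor mkFraction
    field
      num   : D.Carrier
      den   : D.Carrier
      den≉0 : den D.≉ D.0#
  open Fraction public

  ι : D.Carrier → Fraction
  ι p = mkFraction p D.1# D.1≉0

  infix  8 _⁻¹
  infixl 7 _*_ _/_
  infixl 6 _+_ _-_
  infix  4 _≈_

  _≈_ : Fraction → Fraction → Set ℓ
  f ≈ g = num f D.* den g D.≈ num g D.* den f

  _+_ : Fraction → Fraction → Fraction
  f + g = mkFraction (num f D.* den g D.+ num g D.* den f) (den f D.* den g)
                     (D.*-nonZero (den≉0 f) (den≉0 g))

  _*_ : Fraction → Fraction → Fraction
  f * g = mkFraction (num f D.* num g) (den f D.* den g)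
                     (D.*-nonZero (den≉0 f) (den≉0 g))

  -_ : Fraction → Fraction
  - f = mkFraction (D.- num f) (den f) (den≉0 f)

  _-_ : Fraction → Fraction → Fraction
  f - g = f + (- g)

  -- Total by the convention 0 ⁻¹ = 0.
  _⁻¹ : Fraction → Fraction
  f ⁻¹ with D.≈0? (num f)
  ... | yes _    = ι D.0#
  ... | no num≉0 = mkFraction (den f) (num f) num≉0

  _/_ : Fraction → Fraction → Fraction
  f / g = f * g ⁻¹

  rawRing : RawRing (c ⊔ ℓ) ℓ
  rawRing = record
    { _≈_ = _≈_ ; _+_ = _+_ ; _*_ = _*_ ; -_ = -_ ; 0# = ι D.0# ; 1# = ι D.1# }

  open RawRing rawRing public using (0#; 1#)
  open RawSemiringDefs (RawRing.rawSemiring rawRing) public using (_^_; sum)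

  infixr 8 _^ᶻ_
  _^ᶻ_ : Fraction → ℤ → Fraction
  f ^ᶻ (+ m)    = f ^ m
  f ^ᶻ -[1+ m ] = (f ⁻¹) ^ suc m

  ∑ : ℕ → (ℕ → Fraction) → Fraction
  ∑ n f = sum {n} λ k → f (toℕ k)

  infix 5 ∑
  syntax ∑ n (λ k → f) = ∑[ k < n ] f

  -- (y; r)ₘ
  qPochhammer : Fraction → Fraction → ℕ → Fraction
  qPochhammer y r zero    = 1#
  qPochhammer y r (suc m) = qPochhammer y r m * (1# - y * r ^ m)

  infix 4 _≡_[mod_]
  _≡_[mod_] : Fraction → Fraction → D.Carrier → Set (c ⊔ ℓ)
  f ≡ g [mod P ] =
    ∃[ C ] ∃[ E ] Σ[ E≉0 ∈ E D.≉ D.0# ]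
      Coprime (RawRing.rawSemiring D.rawRing) E P × f - g ≈ ι P * mkFraction C E E≉0

ℤ-domain : IntegralDomain 0ℓ 0ℓ
ℤ-domain = record
  { commutativeRing = ℤₚ.+-*-commutativeRing
  ; 1≉0             = λ ()
  ; ≈0?             = ℤₚ._≟ ℤ.0ℤ
  ; *-nonZero       = λ {i} i≢0 j≢0 e → [ i≢0 , j≢0 ]′ (ℤₚ.i*j≡0⇒i≡0∨j≡0 i e)
  }

-- ℤ[a,q,x], built as ((ℤ[x])[q])[a].
module Polynomials where
  module ℤ[x]     = PolynomialDomain ℤ-domain
  module ℤ[q,x]   = PolynomialDomain ℤ[x].polynomialDomain
  module ℤ[a,q,x] = PolynomialDomain ℤ[q,x].polynomialDomain

  domain : IntegralDomain 0ℓ 0ℓ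
  domain = ℤ[a,q,x].polynomialDomain

  open IntegralDomain domain public
  open RawSemiringDefs (RawRing.rawSemiring rawRing) public using (_^_)

  a q x : Carrier
  a = ℤ[a,q,x].X
  q = ℤ[a,q,x].constant ℤ[q,x].X
  x = ℤ[a,q,x].constant (ℤ[q,x].constant ℤ[x].X)

-- ℚ(a,q,x), as the field of fractions of ℤ[a,q,x].
module RationalFunctions where
  open Fractions Polynomials.domain public

  a q x : Fraction
  a = ι Polynomials.a
  q = ι Polynomials.q
  x = ι Polynomials.x

{-# OPTIONS --safe #-}
module Submission where

-- Put s = a + 1/a.  Since P = (1 - a qⁿ)(a - qⁿ) = a (1 + q²ⁿ - qⁿ s) is linear in s up to
-- a unit, and (aq; q²)ₖ (q/a; q²)ₖ = ∏ (1 + q⁴ʲ⁺² - q²ʲ⁺¹ s) depends on a only through s, the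
-- latter is congruent mod P to its value (qⁿ⁺¹; q²)ₖ (q¹⁻ⁿ; q²)ₖ at a = qⁿ.  This reduces the
-- congruence term by term to an identity in ℚ(q, x).  With p = q², n = 2N + 1 that identity
-- is the case b = p^(N+1), d = p^(-N), w = d x of the polynomial identity
--
--   ∑ₖ [N k] (-w)ᵏ p^(k(k-1)/2) (b)ₖ (b d pᵏ)_{N-k}  =  ∑ₖ [N k] (b)ₖ (d)_{N-k} ∏_{j<k} (d - w pʲ).
--
-- By the q-Pascal rule [N+1 k+1] = [N k+1] + p^(N-k) [N k], both sides H_N(b) satisfy
-- H_{N+1}(b) = (1 - b d p^N) H_N(b) - w p^N (1 - b) H_N(b p), hence they agree.
--
-- All denominators are products of powers of a and polynomials in q.  They are coprime to P:
-- a itself divides qⁿ modulo P, and a common divisor of P and a non-zero polynomial free of a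
-- is free of a, so it divides the coefficients -qⁿ and 1 + q²ⁿ of P, hence 1.

open import Defs
open import Algebra.Bundles using (CommutativeRing; RawRing)
open import Algebra.Definitions.RawMagma using (_,_)
open import Algebra.Definitions.RawSemiring using (Coprime)
open import Algebra.Solver.Ring.AlmostCommutativeRing using (fromCommutativeRing; _-Raw-AlmostCommutative⟶_)
open import Algebra.Structures using (IsCommutativeRing)
open import Data.Fin.Base using (toℕ)
open import Data.Integer.Base as ℤ using (ℤ; +_; -[1+_])
open import Data.List.Base using ([]; _∷_)
open import Data.Maybe.Base using (Maybe; just; nothing)
open import Data.Nat.Base as ℕ using (ℕ; zero; suc; _∸_; z≤n; s≤s)
open import Data.Product.Base using (∃-syntax; Σ-syntax; _×_; _,_)
open import Data.Sum.Base using (inj₁; inj₂)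
open import Level using (Level; _⊔_)
open import Relation.Binary.PropositionalEquality as ≡ using (_≡_)
open import Relation.Nullary.Decidable.Core using (yes; no)
open import Relation.Nullary.Negation.Core using (¬_; contradiction)
import Algebra.Properties.AbelianGroup as AbelianGroupProperties
import Algebra.Properties.CommutativeSemiring.Exp as Exp
import Algebra.Properties.Ring as RingProperties
import Algebra.Properties.Semiring.Mult.TCOptimised as Mult
import Algebra.Properties.Semiring.Sum as Sum
import Algebra.Solver.Ring
import Data.Integer.DivMod as ℤ-DivMod
import Data.Integer.Properties as ℤₚ
import Data.Nat.DivMod as ℕ-DivMod
import Data.Nat.Properties as ℕₚ
import Data.Nat.Solver as ℕ-Solver
import Relation.Binary.Reasoning.Setoid as SetoidReasoning

private
  variable
    c ℓ c′ ℓ′ i : Level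

-- Ring solver with integer coefficients over any commutative ring.

module IntegerSolver (R : CommutativeRing c ℓ) where
  open CommutativeRing R
  open RingProperties ring using (-0#≈0#; -‿distribˡ-*; -‿distribʳ-*; -‿involutive)
  open AbelianGroupProperties +-abelianGroup using (⁻¹-∙-comm)
  open Mult semiring using (×-homo-+; ×1-homo-*) renaming (_×_ to _⋆_)
  open SetoidReasoning setoid

  -- The optimised multiple makes `1 ⋆ 1#` reduce to `1#`, so the constants `:1` and `con (+ 0)` in
  -- solved equations stand for `1#` and `0#` themselves.
  fromℤ : ℤ → Carrier
  fromℤ (+ n)    = n ⋆ 1#
  fromℤ -[1+ n ] = - (suc n ⋆ 1#)

  suc-⋆ : ∀ n → suc n ⋆ 1# ≈ 1# + n ⋆ 1#
  suc-⋆ n = ×-homo-+ 1# 1 n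

  fromℤ-⊖ : ∀ m n → fromℤ (m ℤ.⊖ n) ≈ m ⋆ 1# - n ⋆ 1#
  fromℤ-⊖ m       zero    = sym (trans (+-congˡ -0#≈0#) (+-identityʳ _))
  fromℤ-⊖ zero    (suc n) = sym (+-identityˡ _)
  fromℤ-⊖ (suc m) (suc n) = begin
    fromℤ (suc m ℤ.⊖ suc n)                  ≡⟨ ≡.cong fromℤ (ℤₚ.[1+m]⊖[1+n]≡m⊖n m n) ⟩
    fromℤ (m ℤ.⊖ n)                          ≈⟨ fromℤ-⊖ m n ⟩
    m ⋆ 1# - n ⋆ 1#                          ≈⟨ +-congʳ (+-identityʳ _) ⟨
    (m ⋆ 1# + 0#) - n ⋆ 1#                   ≈⟨ +-congʳ (+-congˡ (-‿inverseʳ 1#)) ⟨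
    (m ⋆ 1# + (1# - 1#)) - n ⋆ 1#            ≈⟨ +-congʳ (+-assoc _ _ _) ⟨
    ((m ⋆ 1# + 1#) - 1#) - n ⋆ 1#            ≈⟨ +-congʳ (+-congʳ (+-comm _ _)) ⟩
    ((1# + m ⋆ 1#) - 1#) - n ⋆ 1#            ≈⟨ +-assoc _ _ _ ⟩
    (1# + m ⋆ 1#) + (- 1# - n ⋆ 1#)          ≈⟨ +-congˡ (⁻¹-∙-comm _ _) ⟩
    (1# + m ⋆ 1#) - (1# + n ⋆ 1#)            ≈⟨ +-cong (suc-⋆ m) (-‿cong (suc-⋆ n)) ⟨
    suc m ⋆ 1# - suc n ⋆ 1#                  ∎

  fromℤ-neg : ∀ i → fromℤ (ℤ.- i) ≈ - fromℤ i
  fromℤ-neg (+ zero)  = sym -0#≈0#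
  fromℤ-neg (+ suc n) = refl
  fromℤ-neg -[1+ n ]  = sym (-‿involutive _)

  fromℤ-+ : ∀ i j → fromℤ (i ℤ.+ j) ≈ fromℤ i + fromℤ j
  fromℤ-+ (+ m)    (+ n)    = ×-homo-+ 1# m n
  fromℤ-+ (+ m)    -[1+ n ] = fromℤ-⊖ m (suc n)
  fromℤ-+ -[1+ m ] (+ n)    = trans (fromℤ-⊖ n (suc m)) (+-comm _ _)
  fromℤ-+ -[1+ m ] -[1+ n ] = begin
    - (suc (suc (m ℕ.+ n)) ⋆ 1#)      ≈⟨ -‿cong (suc-⋆ (suc m ℕ.+ n)) ⟩
    - (1# + (suc m ℕ.+ n) ⋆ 1#)       ≈⟨ -‿cong (+-congˡ (×-homo-+ 1# (suc m) n)) ⟩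
    - (1# + (suc m ⋆ 1# + n ⋆ 1#))    ≈⟨ -‿cong (+-assoc _ _ _) ⟨
    - ((1# + suc m ⋆ 1#) + n ⋆ 1#)    ≈⟨ -‿cong (+-congʳ (+-comm _ _)) ⟩
    - ((suc m ⋆ 1# + 1#) + n ⋆ 1#)    ≈⟨ -‿cong (+-assoc _ _ _) ⟩
    - (suc m ⋆ 1# + (1# + n ⋆ 1#))    ≈⟨ -‿cong (+-congˡ (suc-⋆ n)) ⟨
    - (suc m ⋆ 1# + suc n ⋆ 1#)       ≈⟨ ⁻¹-∙-comm _ _ ⟨
    - (suc m ⋆ 1#) - (suc n ⋆ 1#)     ∎

  fromℤ-+* : ∀ m j → fromℤ (+ m ℤ.* j) ≈ fromℤ (+ m) * fromℤ j
  fromℤ-+* m (+ n)    = trans (reflexive (≡.cong fromℤ (≡.sym (ℤₚ.pos-* m n)))) (×1-homo-* m n)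
  fromℤ-+* m -[1+ n ] = begin
    fromℤ (+ m ℤ.* ℤ.- (+ suc n))     ≡⟨ ≡.cong fromℤ (ℤₚ.neg-distribʳ-* (+ m) (+ suc n)) ⟨
    fromℤ (ℤ.- (+ m ℤ.* + suc n))     ≈⟨ fromℤ-neg (+ m ℤ.* + suc n) ⟩
    - fromℤ (+ m ℤ.* + suc n)         ≈⟨ -‿cong (fromℤ-+* m (+ suc n)) ⟩
    - (m ⋆ 1# * (suc n ⋆ 1#))         ≈⟨ -‿distribʳ-* _ _ ⟩
    m ⋆ 1# * - (suc n ⋆ 1#)           ∎

  fromℤ-* : ∀ i j → fromℤ (i ℤ.* j) ≈ fromℤ i * fromℤ j
  fromℤ-* (+ m)    j = fromℤ-+* m j
  fromℤ-* -[1+ m ] j = begin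
    fromℤ (ℤ.- (+ suc m) ℤ.* j)     ≡⟨ ≡.cong fromℤ (ℤₚ.neg-distribˡ-* (+ suc m) j) ⟨
    fromℤ (ℤ.- (+ suc m ℤ.* j))     ≈⟨ fromℤ-neg (+ suc m ℤ.* j) ⟩
    - fromℤ (+ suc m ℤ.* j)         ≈⟨ -‿cong (fromℤ-+* (suc m) j) ⟩
    - (suc m ⋆ 1# * fromℤ j)        ≈⟨ -‿distribˡ-* _ _ ⟩
    - (suc m ⋆ 1#) * fromℤ j        ∎

  homomorphism : ℤ.+-*-rawRing -Raw-AlmostCommutative⟶ fromCommutativeRing R
  homomorphism = record
    { ⟦_⟧    = fromℤ
    ; +-homo = fromℤ-+
    ; *-homo = fromℤ-*
    ; -‿homo = fromℤ-neg
    ; 0-homo = refl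
    ; 1-homo = refl
    }

  fromℤ-≟ : ∀ i j → Maybe (fromℤ i ≈ fromℤ j)
  fromℤ-≟ i j with i ℤₚ.≟ j
  ... | yes i≡j = just (reflexive (≡.cong fromℤ i≡j))
  ... | no  _   = nothing

  open Algebra.Solver.Ring ℤ.+-*-rawRing (fromCommutativeRing R) homomorphism fromℤ-≟ public
    using (Polynomial; solve; con; _:+_; _:*_; _:-_; :-_; _:=_)

  :1 : ∀ {n} → Polynomial n
  :1 = con ℤ.1ℤ

-- tri k = k (k - 1) / 2
tri : ℕ → ℕ
tri zero    = 0
tri (suc k) = tri k ℕ.+ k

-- Finite sums.

module FiniteSums (R : CommutativeRing c ℓ) where
  open CommutativeRing R
  private module S = Sum semiring
  open SetoidReasoning setoid

  ∑ : ℕ → (ℕ → Carrier) → Carrier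
  ∑ n f = S.sum {n} λ k → f (toℕ k)

  ∑-cong : ∀ n {f g} → (∀ k → f k ≈ g k) → ∑ n f ≈ ∑ n g
  ∑-cong n f≈g = S.sum-cong-≋ {n} λ k → f≈g (toℕ k)

  ∑-cong-< : ∀ n {f g} → (∀ {k} → k ℕ.< n → f k ≈ g k) → ∑ n f ≈ ∑ n g
  ∑-cong-< zero    f≈g = refl
  ∑-cong-< (suc n) f≈g = +-cong (f≈g (s≤s z≤n)) (∑-cong-< n λ k<n → f≈g (s≤s k<n))

  ∑-+ : ∀ n f g → ∑ n (λ k → f k + g k) ≈ ∑ n f + ∑ n g
  ∑-+ n f g = S.∑-distrib-+ {n} (λ k → f (toℕ k)) (λ k → g (toℕ k))

  ∑-*ˡ : ∀ n y f → y * ∑ n f ≈ ∑ n (λ k → y * f k)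
  ∑-*ˡ n y f = S.*-distribˡ-sum {n} y (λ k → f (toℕ k))

  ∑-vanish : ∀ n {f} → (∀ k → f k ≈ 0#) → ∑ n f ≈ 0#
  ∑-vanish n f≈0 = trans (∑-cong n {g = λ _ → 0#} f≈0) (S.sum-replicate-zero n)

  ∑-truncate : ∀ {m n} f → m ℕ.≤ n → (∀ {k} → m ℕ.≤ k → f k ≈ 0#) → ∑ n f ≈ ∑ m f
  ∑-truncate {n = n} f z≤n       f≈0 = ∑-vanish n λ k → f≈0 {k} z≤n
  ∑-truncate         f (s≤s m≤n) f≈0 =
    +-congˡ (∑-truncate (λ k → f (suc k)) m≤n λ m≤k → f≈0 (s≤s m≤k))

-- q-shifted factorials and q-binomial coefficients in base p.

module QSeries (R : CommutativeRing c ℓ) where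
  open CommutativeRing R
  open Exp commutativeSemiring using (_^_)

  -- `poch y k` plays the part of (y; p)ₖ. It is known only through its recurrence, so that the
  -- results apply directly to `qPochhammer`.
  module Pochhammer
    (p : Carrier) (poch : Carrier → ℕ → Carrier)
    (poch-zero : ∀ y → poch y 0 ≈ 1#)
    (poch-suc : ∀ y k → poch y (suc k) ≈ poch y k * (1# - y * p ^ k))
    where
    open Exp commutativeSemiring using (^-homo-*; ^-congˡ; ^-congʳ; ^-distrib-*)
    open RingProperties ring using (-‿distribˡ-*)
    open FiniteSums R
    open IntegerSolver R
    open SetoidReasoning setoid

    poch-cong : ∀ {y z} → y ≈ z → ∀ k → poch y k ≈ poch z k
    poch-cong {y} {z} y≈z zero    = trans (poch-zero y) (sym (poch-zero z))
    poch-cong {y} {z} y≈z (suc k) = begin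
      poch y (suc k)                 ≈⟨ poch-suc y k ⟩
      poch y k * (1# - y * p ^ k)    ≈⟨ *-cong (poch-cong y≈z k) (+-congˡ (-‿cong (*-congʳ y≈z))) ⟩
      poch z k * (1# - z * p ^ k)    ≈⟨ poch-suc z k ⟨
      poch z (suc k)                 ∎

    poch-+ : ∀ y k m → poch y (k ℕ.+ m) ≈ poch y k * poch (y * p ^ k) m
    poch-+ y k zero = begin
      poch y (k ℕ.+ 0)               ≡⟨ ≡.cong (poch y) (ℕₚ.+-identityʳ k) ⟩
      poch y k                       ≈⟨ *-identityʳ _ ⟨
      poch y k * 1#                  ≈⟨ *-congˡ (poch-zero _) ⟨
      poch y k * poch (y * p ^ k) 0  ∎
    poch-+ y k (suc m) = begin
      poch y (k ℕ.+ suc m)                                        ≡⟨ ≡.cong (poch y) (ℕₚ.+-suc k m) ⟩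
      poch y (suc (k ℕ.+ m))                                      ≈⟨ poch-suc y (k ℕ.+ m) ⟩
      poch y (k ℕ.+ m) * (1# - y * p ^ (k ℕ.+ m))                 ≈⟨ *-cong (poch-+ y k m) (+-congˡ (-‿cong (trans (*-congˡ (^-homo-* p k m)) (sym (*-assoc _ _ _))))) ⟩
      poch y k * poch (y * p ^ k) m * (1# - y * p ^ k * p ^ m)    ≈⟨ *-assoc _ _ _ ⟩
      poch y k * (poch (y * p ^ k) m * (1# - y * p ^ k * p ^ m))  ≈⟨ *-congˡ (poch-suc _ m) ⟨
      poch y k * poch (y * p ^ k) (suc m)                         ∎

    -- Both sides are (y; p)ₖ₊₁, with the last factor split off on the left and the first on the
    -- right.
    poch-shift : ∀ y k → poch y k * (1# - y * p ^ k) ≈ (1# - y) * poch (y * p) k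
    poch-shift y k = begin
      poch y k * (1# - y * p ^ k)        ≈⟨ poch-suc y k ⟨
      poch y (1 ℕ.+ k)                   ≈⟨ poch-+ y 1 k ⟩
      poch y 1 * poch (y * (p * 1#)) k   ≈⟨ *-cong (poch-suc y 0) (poch-cong (*-congˡ (*-identityʳ p)) k) ⟩
      poch y 0 * (1# - y * 1#) * poch (y * p) k
        ≈⟨ *-congʳ (*-cong (poch-zero y) (+-congˡ (-‿cong (*-identityʳ y)))) ⟩
      1# * (1# - y) * poch (y * p) k     ≈⟨ *-congʳ (*-identityˡ _) ⟩
      (1# - y) * poch (y * p) k          ∎

    -- The q-binomial coefficient, built from the q-Pascal rule and hence free of division. For k >
    -- N the exponent `N ∸ k` is truncated, but there it multiplies `qbin N k`, which is zero.
    qbin : ℕ → ℕ → Carrier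
    qbin _       zero    = 1#
    qbin zero    (suc k) = 0#
    qbin (suc N) (suc k) = qbin N (suc k) + p ^ (N ∸ k) * qbin N k

    qbin-vanish : ∀ {N k} → N ℕ.< k → qbin N k ≈ 0#
    qbin-vanish {zero}  (s≤s _) = refl
    qbin-vanish {suc N} (s≤s N<k) = begin
      _ ≈⟨ +-cong (qbin-vanish (ℕₚ.m<n⇒m<1+n N<k)) (*-congˡ (qbin-vanish N<k)) ⟩
      0# + _ * 0#  ≈⟨ trans (+-identityˡ _) (zeroʳ _) ⟩
      0#           ∎

    ∑-qbin-suc : ∀ N (h : ℕ → Carrier) →
      ∑ (suc (suc N)) (λ k → qbin (suc N) k * h k) ≈
      ∑ (suc N) (λ k → qbin N k * (h k + p ^ (N ∸ k) * h (suc k)))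
    ∑-qbin-suc N h = begin
      1# * h 0 + ∑ (suc N) (λ k → qbin (suc N) (suc k) * h (suc k))
        ≈⟨ +-congˡ (trans (∑-cong (suc N) {g = λ k → v k + u k} λ k → distribʳ _ _ _) (∑-+ (suc N) v u)) ⟩
      1# * h 0 + (∑ (suc N) v + ∑ (suc N) u)
        ≈⟨ +-assoc _ _ _ ⟨
      ∑ (suc (suc N)) (λ k → qbin N k * h k) + ∑ (suc N) u
        -- The q-Pascal parts [N k+1] together with the term k = 0 form a sum over k ≤ N + 1, whose
        -- last term carries [N N+1] = 0.
        ≈⟨ +-congʳ (∑-truncate (λ k → qbin N k * h k) (ℕₚ.n≤1+n (suc N)) λ N<k → trans (*-congʳ (qbin-vanish N<k)) (zeroˡ _)) ⟩
      ∑ (suc N) (λ k → qbin N k * h k) + ∑ (suc N) u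
        ≈⟨ ∑-+ (suc N) (λ k → qbin N k * h k) u ⟨
      ∑ (suc N) (λ k → qbin N k * h k + u k)
        ≈⟨ ∑-cong (suc N) {g = λ k → qbin N k * (h k + p ^ (N ∸ k) * h (suc k))}
             (λ k → solve 4 (λ u v w z → u :* v :+ w :* u :* z := u :* (v :+ w :* z)) refl (qbin N k) (h k) (p ^ (N ∸ k)) (h (suc k))) ⟩
      ∑ (suc N) (λ k → qbin N k * (h k + p ^ (N ∸ k) * h (suc k))) ∎
      where
      u v : ℕ → Carrier
      u k = p ^ (N ∸ k) * qbin N k * h (suc k)
      v k = qbin N (suc k) * h (suc k)

    -- Contiguous relations and the polynomial identity.

    module Transformation (d w : Carrier) where

      -- The summand takes k and m = N - k as separate arguments, so that passing from N to N + 1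
      -- raises either m or k by one.
      qbinSum : (Carrier → ℕ → ℕ → Carrier) → ℕ → Carrier → Carrier
      qbinSum h N b = ∑ (suc N) λ k → qbin N k * h b k (N ∸ k)

      -- The recurrence for H_N(b), asked of each term with N = k + m. The left side is what the
      -- q-Pascal rule makes of the coefficient of [N k] in H_{N+1}(b).
      Contiguous : (Carrier → ℕ → ℕ → Carrier) → Set _
      Contiguous h = ∀ b k m →
        h b k (suc m) + p ^ m * h b (suc k) m ≈
        (1# - b * d * p ^ (k ℕ.+ m)) * h b k m - w * p ^ (k ℕ.+ m) * ((1# - b) * h (b * p) k m)

      qbinSum-suc : ∀ h → Contiguous h → ∀ N b →
        qbinSum h (suc N) b ≈
        (1# - b * d * p ^ N) * qbinSum h N b - w * p ^ N * ((1# - b) * qbinSum h N (b * p))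
      qbinSum-suc h step N b = begin
        qbinSum h (suc N) b
          ≈⟨ ∑-qbin-suc N (λ k → h b k (suc N ∸ k)) ⟩
        ∑ (suc N) (λ k → qbin N k * (h b k (suc N ∸ k) + p ^ (N ∸ k) * h b (suc k) (N ∸ k)))
          ≈⟨ ∑-cong-< (suc N) {g = λ k → u * f k + v * g k} term ⟩
        ∑ (suc N) (λ k → u * f k + v * g k)
          ≈⟨ ∑-+ (suc N) (λ k → u * f k) (λ k → v * g k) ⟩
        ∑ (suc N) (λ k → u * f k) + ∑ (suc N) (λ k → v * g k)
          ≈⟨ +-cong (∑-*ˡ (suc N) u f) (∑-*ˡ (suc N) v g) ⟨
        u * qbinSum h N b + v * qbinSum h N (b * p)
          ≈⟨ +-congˡ (trans (sym (-‿distribˡ-* _ _)) (-‿cong (*-assoc _ _ _))) ⟩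
        u * qbinSum h N b - w * p ^ N * ((1# - b) * qbinSum h N (b * p)) ∎
        where
        u = 1# - b * d * p ^ N
        v = - (w * p ^ N * (1# - b))

        f g : ℕ → Carrier
        f k = qbin N k * h b k (N ∸ k)
        g k = qbin N k * h (b * p) k (N ∸ k)

        term : ∀ {k} → k ℕ.< suc N →
          qbin N k * (h b k (suc N ∸ k) + p ^ (N ∸ k) * h b (suc k) (N ∸ k)) ≈
          u * f k + v * g k
        term {k} (s≤s k≤N) = begin
          qbin N k * (h b k (suc N ∸ k) + p ^ m * h b (suc k) m)
            ≡⟨ ≡.cong (λ i → qbin N k * (h b k i + p ^ m * h b (suc k) m)) (ℕₚ.+-∸-assoc 1 k≤N) ⟩
          qbin N k * (h b k (suc m) + p ^ m * h b (suc k) m)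
            ≈⟨ *-congˡ (step b k m) ⟩
          qbin N k * ((1# - b * d * p ^ (k ℕ.+ m)) * h b k m - w * p ^ (k ℕ.+ m) * ((1# - b) * h (b * p) k m))
            ≡⟨ ≡.cong (λ i → qbin N k * ((1# - b * d * p ^ i) * h b k m - w * p ^ i * ((1# - b) * h (b * p) k m))) (ℕₚ.m+[n∸m]≡n k≤N) ⟩
          qbin N k * (u * h b k m - w * p ^ N * ((1# - b) * h (b * p) k m))
            ≈⟨ solve 6 (λ c u s t y z → c :* (u :* y :- s :* (t :* z)) := u :* (c :* y) :+ (:- (s :* t)) :* (c :* z))
                 refl (qbin N k) u (w * p ^ N) (1# - b) (h b k m) (h (b * p) k m) ⟩
          u * (qbin N k * h b k m) + v * (qbin N k * h (b * p) k m) ∎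
          where m = N ∸ k

      -- Induction on N with b universally quantified, since the recurrence calls on the value at b
      -- p.
      qbinSum-unique : ∀ g h → Contiguous g → Contiguous h → (∀ b → g b 0 0 ≈ h b 0 0) →
        ∀ N b → qbinSum g N b ≈ qbinSum h N b
      qbinSum-unique g h stepᵍ stepʰ g≈h zero    b = +-congʳ (*-congˡ (g≈h b))
      qbinSum-unique g h stepᵍ stepʰ g≈h (suc N) b = begin
        qbinSum g (suc N) b  ≈⟨ qbinSum-suc g stepᵍ N b ⟩
        _                    ≈⟨ +-cong (*-congˡ (ih b)) (-‿cong (*-congˡ (*-congˡ (ih (b * p))))) ⟩
        _                    ≈⟨ qbinSum-suc h stepʰ N b ⟨
        qbinSum h (suc N) b  ∎
        where ih = qbinSum-unique g h stepᵍ stepʰ g≈h N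

      lower : ℕ → Carrier
      lower zero    = 1#
      lower (suc k) = lower k * (d - w * p ^ k)

      left right : Carrier → ℕ → ℕ → Carrier
      left  b k m = (- w) ^ k * p ^ tri k * poch b k * poch (b * d * p ^ k) m
      right b k m = poch b k * poch d m * lower k

      -- The two terms match one by one. Raising m appends the factor 1 - b d p^(k+m); raising k
      -- turns (b)ₖ₊₁ into (1 - b)(b p)ₖ, and b d p^(k+1) is (b p) d p^k.
      left-contiguous : Contiguous left
      left-contiguous b k m = begin
        U * T * B * poch (b * d * K) (suc m) + M * ((- w * U) * p ^ (tri k ℕ.+ k) * poch b (suc k) * poch (b * d * (p * K)) m)
          ≈⟨ +-cong (*-congˡ (poch-suc (b * d * K) m))
               (*-congˡ (*-cong (*-cong (*-congˡ (^-homo-* p (tri k) k)) (trans (poch-suc b k) (poch-shift b k)))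
                               (poch-cong shift m))) ⟩
        U * T * B * (C * (1# - b * d * K * M)) + M * ((- w * U) * (T * K) * ((1# - b) * B′) * C′)
          ≈⟨ +-cong
               (solve 8 (λ U T B C b d K M → U :* T :* B :* (C :* (:1 :- b :* d :* K :* M))
                           := (:1 :- b :* d :* (K :* M)) :* (U :* T :* B :* C)) refl U T B C b d K M)
               (solve 8 (λ U T B C b w K M → M :* ((:- w) :* U :* (T :* K) :* ((:1 :- b) :* B) :* C)
                           := :- (w :* (K :* M) :* ((:1 :- b) :* (U :* T :* B :* C)))) refl U T B′ C′ b w K M) ⟩
        (1# - b * d * (K * M)) * (U * T * B * C) - w * (K * M) * ((1# - b) * (U * T * B′ * C′))
          ≈⟨ +-cong (*-congʳ (+-congˡ (-‿cong (*-congˡ KM)))) (-‿cong (*-congʳ (*-congˡ KM))) ⟩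
        (1# - b * d * p ^ (k ℕ.+ m)) * left b k m - w * p ^ (k ℕ.+ m) * ((1# - b) * left (b * p) k m) ∎
        where
        U = (- w) ^ k
        T = p ^ tri k
        K = p ^ k
        M = p ^ m
        B = poch b k
        B′ = poch (b * p) k
        C = poch (b * d * K) m
        C′ = poch (b * p * d * K) m
        KM = sym (^-homo-* p k m)
        shift = solve 4 (λ b d p K → b :* d :* (p :* K) := b :* p :* d :* K) refl b d p K

      -- Here the terms only match in total, through (1 - d M) + M (1 - b K)(d - w K) = (1 - b d K
      -- M) - w K M (1 - b K); then `poch-shift` absorbs 1 - b K.
      right-contiguous : Contiguous right
      right-contiguous b k m = begin
        B * poch d (suc m) * S + M * (poch b (suc k) * D * (S * (d - w * K)))
          ≈⟨ +-cong (*-congʳ (*-congˡ (poch-suc d m))) (*-congˡ (*-congʳ (*-congʳ (poch-suc b k)))) ⟩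
        B * (D * (1# - d * M)) * S + M * (B * (1# - b * K) * D * (S * (d - w * K)))
          ≈⟨ solve 8 (λ B D S b d w K M →
               B :* (D :* (:1 :- d :* M)) :* S :+ M :* (B :* (:1 :- b :* K) :* D :* (S :* (d :- w :* K)))
               := (:1 :- b :* d :* (K :* M)) :* (B :* D :* S) :- w :* (K :* M) :* ((B :* (:1 :- b :* K)) :* (D :* S)))
               refl B D S b d w K M ⟩
        (1# - b * d * (K * M)) * (B * D * S) - w * (K * M) * ((B * (1# - b * K)) * (D * S))
          ≈⟨ +-cong (*-congʳ (+-congˡ (-‿cong (*-congˡ KM))))
               (-‿cong (*-cong (*-congˡ KM) (trans (*-congʳ (poch-shift b k))
                  (solve 4 (λ u v y z → u :* v :* (y :* z) := u :* (v :* y :* z)) refl _ _ _ _)))) ⟩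
        (1# - b * d * p ^ (k ℕ.+ m)) * right b k m - w * p ^ (k ℕ.+ m) * ((1# - b) * right (b * p) k m) ∎
        where
        K = p ^ k
        M = p ^ m
        B = poch b k
        D = poch d m
        S = lower k
        KM = sym (^-homo-* p k m)

      transformation : ∀ N b → qbinSum left N b ≈ qbinSum right N b
      transformation = qbinSum-unique left right left-contiguous right-contiguous λ b → begin
        1# * 1# * poch b 0 * poch (b * d * 1#) 0
          ≈⟨ *-cong (trans (*-congʳ (*-identityˡ 1#)) (*-identityˡ _)) (trans (poch-zero _) (sym (poch-zero _))) ⟩
        poch b 0 * poch d 0        ≈⟨ *-identityʳ _ ⟨
        poch b 0 * poch d 0 * 1#   ∎

    -- Product form of the q-binomial coefficients.

    falling : ℕ → ℕ → Carrier
    falling N zero    = 1#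
    falling N (suc k) = falling N k * (p ^ k - p ^ N)

    -- The factor j = 0 is 1 - p^(N+1), and each of the k others is p times a factor of
    -- `falling N k`.
    falling-suc : ∀ N k → falling (suc N) (suc k) ≈ (1# - p ^ suc N) * p ^ k * falling N k
    falling-suc N zero    = solve 1 (λ y → :1 :* (:1 :- y) := (:1 :- y) :* :1 :* :1) refl (p ^ suc N)
    falling-suc N (suc k) = begin
      falling (suc N) (suc k) * (p ^ suc k - p ^ suc N)
        ≈⟨ *-congʳ (falling-suc N k) ⟩
      (1# - p ^ suc N) * p ^ k * falling N k * (p * p ^ k - p * p ^ N)
        ≈⟨ solve 5 (λ u K f p M → u :* K :* f :* (p :* K :- p :* M) := u :* (p :* K) :* (f :* (K :- M)))
             refl (1# - p ^ suc N) (p ^ k) (falling N k) p (p ^ N) ⟩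
      (1# - p ^ suc N) * p ^ suc k * falling N (suc k) ∎

    -- The product formula for [N k], cleared of denominators. It also covers k > N, where
    -- `falling N k` contains the zero factor p^N - p^N.
    qbin-falling : ∀ N k → qbin N k * poch p k * p ^ tri k ≈ falling N k
    qbin-falling N zero = trans (*-congʳ (trans (*-identityˡ _) (poch-zero p))) (*-identityʳ 1#)
    qbin-falling zero (suc k) = trans (trans (*-congʳ (zeroˡ _)) (zeroˡ _)) (sym (falling-0-suc k))
      where
      falling-0-suc : ∀ k → falling 0 (suc k) ≈ 0#
      falling-0-suc zero    = trans (*-congˡ (-‿inverseʳ 1#)) (zeroʳ _)
      falling-0-suc (suc k) = trans (*-congʳ (falling-0-suc k)) (zeroˡ _)
    qbin-falling (suc N) (suc k) = begin
      (qbin N (suc k) + p ^ (N ∸ k) * qbin N k) * poch p (suc k) * p ^ (tri k ℕ.+ k)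
        ≈⟨ trans (*-assoc _ _ _) (trans (distribʳ _ _ _) (+-cong (sym (*-assoc _ _ _)) refl)) ⟩
      qbin N (suc k) * poch p (suc k) * p ^ tri (suc k) + p ^ (N ∸ k) * qbin N k * (poch p (suc k) * p ^ (tri k ℕ.+ k))
        ≈⟨ +-cong (qbin-falling N (suc k)) (*-congˡ (*-cong (poch-suc p k) (^-homo-* p (tri k) k))) ⟩
      falling N k * (K - p ^ N) + p ^ (N ∸ k) * qbin N k * (poch p k * (1# - p * K) * (p ^ tri k * K))
        ≈⟨ +-congˡ (solve 6 (λ M Q G T p K → M :* Q :* (G :* (:1 :- p :* K) :* (T :* K)) := (Q :* G :* T) :* (M :* K) :* (:1 :- p :* K))
             refl (p ^ (N ∸ k)) (qbin N k) (poch p k) (p ^ tri k) p K) ⟩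
      falling N k * (K - p ^ N) + qbin N k * poch p k * p ^ tri k * (p ^ (N ∸ k) * K) * (1# - p * K)
        ≈⟨ +-congˡ (*-congʳ power) ⟩
      falling N k * (K - p ^ N) + falling N k * p ^ N * (1# - p * K)
        ≈⟨ solve 4 (λ f K M p → f :* (K :- M) :+ f :* M :* (:1 :- p :* K) := (:1 :- p :* M) :* K :* f) refl (falling N k) K (p ^ N) p ⟩
      (1# - p ^ suc N) * K * falling N k
        ≈⟨ falling-suc N k ⟨
      falling (suc N) (suc k) ∎
      where
      K = p ^ k

      power : qbin N k * poch p k * p ^ tri k * (p ^ (N ∸ k) * K) ≈ falling N k * p ^ N
      power with ℕₚ.≤-<-connex k N
      ... | inj₁ k≤N = *-cong (qbin-falling N k)
              (trans (sym (^-homo-* p (N ∸ k) k)) (^-congʳ p (ℕₚ.m∸n+n≡m k≤N)))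
      -- Truncated subtraction spoils p^(N-k) p^k = p^N here, but both sides are zero: the left
      -- because [N k] = 0, the right by the induction hypothesis.
      ... | inj₂ N<k = begin
        qbin N k * poch p k * p ^ tri k * _   ≈⟨ *-congʳ vanish ⟩
        0# * _                                ≈⟨ trans (zeroˡ _) (sym (zeroˡ _)) ⟩
        0# * p ^ N                            ≈⟨ *-congʳ (trans (sym vanish) (qbin-falling N k)) ⟩
        falling N k * p ^ N                   ∎
        where
        vanish : qbin N k * poch p k * p ^ tri k ≈ 0#
        vanish = trans (*-congʳ (trans (*-congʳ (qbin-vanish N<k)) (zeroˡ _))) (zeroˡ _)

    ^-inverse : ∀ {y z} → y * z ≈ 1# → ∀ k → y ^ k * z ^ k ≈ 1#
    ^-inverse {y} {z} yz≈1 zero    = *-identityˡ 1#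
    ^-inverse {y} {z} yz≈1 (suc k) = begin
      y * y ^ k * (z * z ^ k)    ≈⟨ solve 4 (λ y z Y Z → y :* Y :* (z :* Z) := y :* z :* (Y :* Z)) refl y z (y ^ k) (z ^ k) ⟩
      y * z * (y ^ k * z ^ k)    ≈⟨ *-cong yz≈1 (^-inverse yz≈1 k) ⟩
      1# * 1#                    ≈⟨ *-identityˡ 1# ⟩
      1#                         ∎

    -- The transformation at b = p ^ suc N, d = p ^ (- N) and w = d x, divided by (p; p)_N.
    module Terminating
      (e : Carrier) (pe≈1 : p * e ≈ 1#)
      (s : ℕ → Carrier) (s-inverse : ∀ k → s k * (poch p k * poch p k) ≈ 1#)
      (x : Carrier) (N : ℕ)
      where

      -- For p = q² the constant `c₀` is (-1)^N q^(-N(N+1)), the prefactor of the theorem at n = 2N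
      -- + 1.
      b d c₀ : Carrier
      b  = p ^ suc N
      d  = e ^ N
      c₀ = (- 1#) ^ N * e ^ tri (suc N)

      open Transformation d (d * x)

      -- The coefficient (aq; q²)ₖ (q/a; q²)ₖ / (q²; q²)ₖ² evaluated at a = qⁿ.
      τ : ℕ → Carrier
      τ k = poch b k * poch d k * s k

      d-inverse : p ^ N * d ≈ 1#
      d-inverse = ^-inverse pe≈1 N

      -- Since p^N d = 1, multiplying p^j - p^N by -d gives 1 - d p^j.
      falling-poch : ∀ k → falling N k * (- d) ^ k ≈ poch d k
      falling-poch zero    = trans (*-identityˡ 1#) (sym (poch-zero d))
      falling-poch (suc k) = begin
        falling N k * (p ^ k - p ^ N) * (- d * (- d) ^ k)
          ≈⟨ solve 5 (λ f K M d D → f :* (K :- M) :* (:- d :* D) := f :* D :* (M :* d :- d :* K)) refl (falling N k) (p ^ k) (p ^ N) d ((- d) ^ k) ⟩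
        falling N k * (- d) ^ k * (p ^ N * d - d * p ^ k)
          ≈⟨ *-cong (falling-poch k) (+-congʳ d-inverse) ⟩
        poch d k * (1# - d * p ^ k)
          ≈⟨ poch-suc d k ⟨
        poch d (suc k) ∎

      qbin-poch : ∀ k → qbin N k * poch p k * p ^ tri k * (- d) ^ k ≈ poch d k
      qbin-poch k = trans (*-congʳ (qbin-falling N k)) (falling-poch k)

      -- The factor 1 - d p^N of (d; p)ₖ is zero. This is why the sums terminate at N.
      poch-d-vanish : ∀ {k} → N ℕ.< k → poch d k ≈ 0#
      poch-d-vanish {k} N<k = begin
        poch d k                                ≡⟨ ≡.cong (poch d) (ℕₚ.m+[n∸m]≡n N<k) ⟨
        poch d (suc N ℕ.+ (k ∸ suc N))          ≈⟨ poch-+ d (suc N) (k ∸ suc N) ⟩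
        poch d (suc N) * _                      ≈⟨ *-congʳ (poch-suc d N) ⟩
        poch d N * (1# - d * p ^ N) * _         ≈⟨ *-congʳ (*-congˡ (trans (+-congˡ (-‿cong (trans (*-comm _ _) d-inverse))) (-‿inverseʳ 1#))) ⟩
        poch d N * 0# * _                       ≈⟨ trans (*-congʳ (zeroʳ _)) (zeroˡ _) ⟩
        0#                                      ∎

      τ-vanish : ∀ {k} → N ℕ.< k → τ k ≈ 0#
      τ-vanish N<k = trans (*-congʳ (trans (*-congˡ (poch-d-vanish N<k)) (zeroʳ _))) (zeroˡ _)

      -- This turns (b d p^k)_{N-k} into (p^(k+1))_{N-k}, the part missing from (p)ₖ to make (p)_N.
      bd≈p : b * d ≈ p
      bd≈p = trans (*-assoc _ _ _) (trans (*-congˡ d-inverse) (*-identityʳ p))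

      sign : ℕ → Carrier
      sign k = (- 1#) ^ k

      sign-inverse : ∀ k → sign k * sign k ≈ 1#
      sign-inverse = ^-inverse (solve 0 ((:- :1) :* (:- :1) := :1) refl)

      -- Reversal of (p^(-N))_m with m = N - k: up to sign and a power of p it is (p)_N / (p)ₖ. The
      -- induction on m moves k up towards N, where all signs and powers cancel.
      poch-d-reverse : ∀ m k → k ℕ.+ m ≡ N →
        poch d m * poch p k ≈ c₀ * poch p N * (p ^ tri (suc k) * sign k)
      poch-d-reverse zero k ≡.refl = begin
        poch d 0 * poch p k
          ≈⟨ *-cong (poch-zero d) (reflexive (≡.cong (poch p) (≡.sym (ℕₚ.+-identityʳ k)))) ⟩
        1# * poch p N
          ≈⟨ *-congʳ (trans (*-cong (sign-inverse N) (^-inverse pe≈1 (tri (suc N)))) (*-identityˡ 1#)) ⟨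
        sign N * sign N * (p ^ tri (suc N) * e ^ tri (suc N)) * poch p N
          ≈⟨ solve 4 (λ σ P E G → σ :* σ :* (P :* E) :* G := σ :* E :* G :* (P :* σ)) refl (sign N) (p ^ tri (suc N)) (e ^ tri (suc N)) (poch p N) ⟩
        c₀ * poch p N * (p ^ tri (suc N) * sign N)
          ≡⟨ ≡.cong (λ i → c₀ * poch p N * (p ^ tri (suc i) * sign i)) (ℕₚ.+-identityʳ k) ⟩
        c₀ * poch p N * (p ^ tri (suc k) * sign k) ∎
      poch-d-reverse (suc m) k k+1+m≡N = begin
        poch d (suc m) * poch p k
          ≈⟨ *-congʳ (poch-suc d m) ⟩
        poch d m * (1# - d * p ^ m) * poch p k
          -- With E = p^(-k-1) = d p^m, the last factor 1 - d p^m is -E (1 - p^(k+1)), which extends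
          -- (p)ₖ to (p)ₖ₊₁.
          ≈⟨ *-congʳ (*-congˡ (+-cong (sym (^-inverse pe≈1 (suc k))) (-‿cong dM≈E))) ⟩
        poch d m * (p ^ suc k * E - E) * poch p k
          ≈⟨ solve 4 (λ D P E G → D :* (P :* E :- E) :* G := :- E :* (D :* (G :* (:1 :- P)))) refl (poch d m) (p ^ suc k) E (poch p k) ⟩
        - E * (poch d m * (poch p k * (1# - p * p ^ k)))
          ≈⟨ *-congˡ (*-congˡ (poch-suc p k)) ⟨
        - E * (poch d m * poch p (suc k))
          ≈⟨ *-congˡ (poch-d-reverse m (suc k) 1+k+m≡N) ⟩
        - E * (c₀ * poch p N * (p ^ (tri (suc k) ℕ.+ suc k) * (- 1# * sign k)))
          ≈⟨ *-congˡ (*-congˡ (*-congʳ (^-homo-* p (tri (suc k)) (suc k)))) ⟩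
        - E * (c₀ * poch p N * (p ^ tri (suc k) * p ^ suc k * (- 1# * sign k)))
          ≈⟨ solve 5 (λ E c T P σ → :- E :* (c :* (T :* P :* (:- :1 :* σ))) := c :* (T :* σ) :* (P :* E)) refl E (c₀ * poch p N) (p ^ tri (suc k)) (p ^ suc k) (sign k) ⟩
        c₀ * poch p N * (p ^ tri (suc k) * sign k) * (p ^ suc k * E)
          ≈⟨ trans (*-congˡ (^-inverse pe≈1 (suc k))) (*-identityʳ _) ⟩
        c₀ * poch p N * (p ^ tri (suc k) * sign k) ∎
        where
        E = e ^ suc k

        1+k+m≡N : suc k ℕ.+ m ≡ N
        1+k+m≡N = ≡.trans (≡.sym (ℕₚ.+-suc k m)) k+1+m≡N

        dM≈E : d * p ^ m ≈ E
        dM≈E = begin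
          e ^ N * p ^ m                     ≡⟨ ≡.cong (λ i → e ^ i * p ^ m) 1+k+m≡N ⟨
          e ^ (suc k ℕ.+ m) * p ^ m         ≈⟨ *-congʳ (^-homo-* e (suc k) m) ⟩
          E * e ^ m * p ^ m                 ≈⟨ *-assoc _ _ _ ⟩
          E * (e ^ m * p ^ m)               ≈⟨ *-congˡ (trans (*-comm _ _) (^-inverse pe≈1 m)) ⟩
          E * 1#                            ≈⟨ *-identityʳ E ⟩
          E                                 ∎

      lower-poch : ∀ k → lower k ≈ d ^ k * poch x k
      lower-poch zero    = sym (trans (*-identityˡ _) (poch-zero x))
      lower-poch (suc k) = begin
        lower k * (d - d * x * p ^ k)
          ≈⟨ *-congʳ (lower-poch k) ⟩
        d ^ k * poch x k * (d - d * x * p ^ k)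
          ≈⟨ solve 5 (λ D X d x K → D :* X :* (d :- d :* x :* K) := d :* D :* (X :* (:1 :- x :* K))) refl (d ^ k) (poch x k) d x (p ^ k) ⟩
        d ^ suc k * (poch x k * (1# - x * p ^ k))
          ≈⟨ *-congˡ (poch-suc x k) ⟨
        d ^ suc k * poch x (suc k) ∎

      left-term : ∀ k m → k ℕ.+ m ≡ N → qbin N k * left b k m ≈ poch p N * (τ k * x ^ k)
      left-term k m k+m≡N = begin
        Q * ((- (d * x)) ^ k * T * B * poch (b * d * p ^ k) m)
          ≈⟨ *-congˡ (*-cong (*-congʳ (*-congʳ power)) (poch-cong (*-congʳ bd≈p) m)) ⟩
        Q * (V * X * T * B * C)
          ≈⟨ *-identityˡ _ ⟨
        1# * (Q * (V * X * T * B * C))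
          -- Of the two factors (p)ₖ inserted with `s k`, one completes (p^(k+1))_{N-k} to (p)_N and
          -- the other converts [N k] into (d)ₖ by `qbin-poch`.
          ≈⟨ *-congʳ (s-inverse k) ⟨
        s k * (G * G) * (Q * (V * X * T * B * C))
          ≈⟨ solve 8 (λ s G Q V X T B C → s :* (G :* G) :* (Q :* (V :* X :* T :* B :* C)) := (G :* C) :* (B :* (Q :* G :* T :* V) :* s :* X)) refl (s k) G Q V X T B C ⟩
        (G * C) * (B * (Q * G * T * V) * s k * X)
          ≈⟨ *-cong (trans (sym (poch-+ p k m)) (reflexive (≡.cong (poch p) k+m≡N))) (*-congʳ (*-congʳ (*-congˡ (qbin-poch k)))) ⟩
        poch p N * (τ k * x ^ k) ∎
        where
        Q = qbin N k
        G = poch p k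
        T = p ^ tri k
        V = (- d) ^ k
        X = x ^ k
        B = poch b k
        C = poch (p * p ^ k) m

        power : (- (d * x)) ^ k ≈ V * X
        power = trans (^-congˡ k (-‿distribˡ-* d x)) (^-distrib-* (- d) x k)

      -- One inserted (p)ₖ again converts [N k] into (d)ₖ; the other reverses (d)_{N-k}. The powers
      -- p^(k(k+1)/2) from the reversal and p^(-k(k-1)/2) from the conversion leave p^k, which
      -- becomes q^(2k).
      right-term : ∀ k m → k ℕ.+ m ≡ N →
        qbin N k * right b k m ≈ poch p N * (c₀ * (τ k * p ^ k * poch x k))
      right-term k m k+m≡N = begin
        Q * (B * D * lower k)
          ≈⟨ *-congˡ (*-congˡ (lower-poch k)) ⟩
        Q * (B * D * (d ^ k * X))
          ≈⟨ trans (*-congʳ (trans (*-cong (s-inverse k) (^-inverse pe≈1 (tri k))) (*-identityˡ 1#))) (*-identityˡ _) ⟨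
        s k * (G * G) * (T * E) * (Q * (B * D * (d ^ k * X)))
          ≈⟨ trans (*-congʳ (sign-inverse k)) (*-identityˡ _) ⟨
        σ * σ * (s k * (G * G) * (T * E) * (Q * (B * D * (d ^ k * X))))
          ≈⟨ *-commutative-shuffle ⟩
        (B * (Q * G * T * (σ * d ^ k)) * s k) * X * (D * G) * (E * σ)
          ≈⟨ *-congʳ (*-cong (*-congʳ (*-congʳ (*-congˡ (trans (*-congˡ (sym power)) (qbin-poch k))))) (poch-d-reverse m k k+m≡N)) ⟩
        τ k * X * (c₀ * poch p N * (p ^ (tri k ℕ.+ k) * σ)) * (E * σ)
          ≈⟨ *-congʳ (*-congˡ (*-congˡ (*-congʳ (^-homo-* p (tri k) k)))) ⟩
        τ k * X * (c₀ * poch p N * (T * K * σ)) * (E * σ)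
          ≈⟨ solve 8 (λ t X c P T K σ E → t :* X :* (c :* P :* (T :* K :* σ)) :* (E :* σ) := P :* (c :* (t :* K :* X)) :* (σ :* σ :* (T :* E)))
               refl (τ k) X c₀ (poch p N) T K σ E ⟩
        poch p N * (c₀ * (τ k * K * X)) * (σ * σ * (T * E))
          ≈⟨ trans (*-congˡ (trans (*-cong (sign-inverse k) (^-inverse pe≈1 (tri k))) (*-identityˡ 1#))) (*-identityʳ _) ⟩
        poch p N * (c₀ * (τ k * p ^ k * poch x k)) ∎
        where
        Q = qbin N k
        G = poch p k
        T = p ^ tri k
        E = e ^ tri k
        K = p ^ k
        X = poch x k
        B = poch b k
        D = poch d m
        σ = sign k

        power : (- d) ^ k ≈ σ * d ^ k
        power = trans (^-congˡ k (solve 1 (λ d → :- d := :- :1 :* d) refl d)) (^-distrib-* (- 1#) d k)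

        *-commutative-shuffle :
          σ * σ * (s k * (G * G) * (T * E) * (Q * (B * D * (d ^ k * X)))) ≈
          (B * (Q * G * T * (σ * d ^ k)) * s k) * X * (D * G) * (E * σ)
        *-commutative-shuffle = solve 10 (λ σ s G T E Q B D δ X →
          σ :* σ :* (s :* (G :* G) :* (T :* E) :* (Q :* (B :* D :* (δ :* X)))) :=
          (B :* (Q :* G :* T :* (σ :* δ)) :* s) :* X :* (D :* G) :* (E :* σ)) refl σ (s k) G T E Q B D (d ^ k) X

      f g : ℕ → Carrier
      f k = τ k * x ^ k
      g k = τ k * p ^ k * poch x k

      scaled : poch p N * ∑ (suc N) f ≈ poch p N * (c₀ * ∑ (suc N) g)
      scaled = begin
        poch p N * ∑ (suc N) f
          ≈⟨ ∑-*ˡ (suc N) (poch p N) f ⟩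
        ∑ (suc N) (λ k → poch p N * f k)
          ≈⟨ ∑-cong-< (suc N) {g = λ k → poch p N * f k} (λ { {k} (s≤s k≤N) → left-term k (N ∸ k) (ℕₚ.m+[n∸m]≡n k≤N) }) ⟨
        qbinSum left N b
          ≈⟨ transformation N b ⟩
        qbinSum right N b
          ≈⟨ ∑-cong-< (suc N) {g = λ k → poch p N * (c₀ * g k)} (λ { {k} (s≤s k≤N) → right-term k (N ∸ k) (ℕₚ.m+[n∸m]≡n k≤N) }) ⟩
        ∑ (suc N) (λ k → poch p N * (c₀ * g k))
          ≈⟨ ∑-*ˡ (suc N) (poch p N) (λ k → c₀ * g k) ⟨
        poch p N * ∑ (suc N) (λ k → c₀ * g k)
          ≈⟨ *-congˡ (∑-*ˡ (suc N) c₀ g) ⟨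
        poch p N * (c₀ * ∑ (suc N) g) ∎

      -- (p)_N is a unit with inverse `s N * poch p N`.
      poch-p-cancel : ∀ {y z} → poch p N * y ≈ poch p N * z → y ≈ z
      poch-p-cancel {y} {z} e = trans (unit y) (trans (*-congˡ e) (sym (unit z)))
        where
        unit : ∀ y → y ≈ s N * poch p N * (poch p N * y)
        unit y = begin
          y                                      ≈⟨ *-identityˡ y ⟨
          1# * y                                 ≈⟨ *-congʳ (s-inverse N) ⟨
          s N * (poch p N * poch p N) * y        ≈⟨ solve 3 (λ s G y → s :* (G :* G) :* y := s :* G :* (G :* y)) refl (s N) (poch p N) y ⟩
          s N * poch p N * (poch p N * y)        ∎

      terminating : ∀ {n} → N ℕ.< n → ∑ n f ≈ c₀ * ∑ n g
      terminating {n} N<n = begin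
        ∑ n f                 ≈⟨ ∑-truncate f N<n (λ N<k → trans (*-congʳ (τ-vanish N<k)) (zeroˡ _)) ⟩
        ∑ (suc N) f           ≈⟨ poch-p-cancel scaled ⟩
        c₀ * ∑ (suc N) g      ≈⟨ *-congˡ (∑-truncate g N<n (λ N<k → trans (*-congʳ (trans (*-congʳ (τ-vanish N<k)) (zeroˡ _))) (zeroˡ _))) ⟨
        c₀ * ∑ n g            ∎

-- Subrings, and congruence modulo P with quotients in a subring.

record Subring (R : CommutativeRing c ℓ) (i : Level) : Set (c ⊔ ℓ ⊔ Level.suc i) where
  open CommutativeRing R
  field
    _∈   : Carrier → Set i
    resp : ∀ {y z} → y ≈ z → y ∈ → z ∈
    1∈   : 1# ∈
    +∈   : ∀ {y z} → y ∈ → z ∈ → (y + z) ∈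
    *∈   : ∀ {y z} → y ∈ → z ∈ → (y * z) ∈
    -∈   : ∀ {y} → y ∈ → (- y) ∈

  open Exp commutativeSemiring using (_^_)

  0∈ : 0# ∈
  0∈ = resp (-‿inverseʳ 1#) (+∈ 1∈ (-∈ 1∈))

  ^∈ : ∀ {y} → y ∈ → ∀ k → (y ^ k) ∈
  ^∈ y∈ zero    = 1∈
  ^∈ y∈ (suc k) = *∈ y∈ (^∈ y∈ k)

module Congruence {R : CommutativeRing c ℓ} (S : Subring R i) (P : CommutativeRing.Carrier R) where
  open CommutativeRing R
  open Subring S
  open FiniteSums R
  open IntegerSolver R
  open SetoidReasoning setoid

  infix 4 _∼_
  -- Only the quotient is confined to the subring. In a field, an unrestricted quotient would make
  -- all elements congruent modulo a non-zero P.
  _∼_ : Carrier → Carrier → Set _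
  y ∼ z = ∃[ h ] h ∈ × y - z ≈ P * h

  ∼-reflexive : ∀ {y z} → y ≈ z → y ∼ z
  ∼-reflexive {y} {z} y≈z = 0# , 0∈ , (begin
    y - z    ≈⟨ +-congʳ y≈z ⟩
    z - z    ≈⟨ -‿inverseʳ z ⟩
    0#       ≈⟨ zeroʳ P ⟨
    P * 0#   ∎)

  ∼-sym : ∀ {y z} → y ∼ z → z ∼ y
  ∼-sym {y} {z} (h , h∈ , e) = - h , -∈ h∈ , (begin
    z - y       ≈⟨ solve 2 (λ y z → z :- y := :- (y :- z)) refl y z ⟩
    - (y - z)   ≈⟨ -‿cong e ⟩
    - (P * h)   ≈⟨ solve 2 (λ P h → :- (P :* h) := P :* :- h) refl P h ⟩
    P * - h     ∎)

  ∼-trans : ∀ {y z w} → y ∼ z → z ∼ w → y ∼ w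
  ∼-trans {y} {z} {w} (h , h∈ , e) (h′ , h′∈ , e′) = h + h′ , +∈ h∈ h′∈ , (begin
    y - w               ≈⟨ solve 3 (λ y z w → y :- w := (y :- z) :+ (z :- w)) refl y z w ⟩
    (y - z) + (z - w)   ≈⟨ +-cong e e′ ⟩
    P * h + P * h′      ≈⟨ distribˡ _ _ _ ⟨
    P * (h + h′)        ∎)

  ∼-+ : ∀ {y z y′ z′} → y ∼ z → y′ ∼ z′ → y + y′ ∼ z + z′
  ∼-+ {y} {z} {y′} {z′} (h , h∈ , e) (h′ , h′∈ , e′) = h + h′ , +∈ h∈ h′∈ , (begin
    (y + y′) - (z + z′)   ≈⟨ solve 4 (λ y z y′ z′ → (y :+ y′) :- (z :+ z′) := (y :- z) :+ (y′ :- z′)) refl y z y′ z′ ⟩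
    (y - z) + (y′ - z′)   ≈⟨ +-cong e e′ ⟩
    P * h + P * h′        ≈⟨ distribˡ _ _ _ ⟨
    P * (h + h′)          ∎)

  -- From y y′ - z z′ = y (y′ - z′) + (y - z) z′, the elements that enter the quotient are y and z′.
  ∼-* : ∀ {y z y′ z′} → y ∈ → z′ ∈ → y ∼ z → y′ ∼ z′ → y * y′ ∼ z * z′
  ∼-* {y} {z} {y′} {z′} y∈ z′∈ (h , h∈ , e) (h′ , h′∈ , e′) = y * h′ + h * z′ , +∈ (*∈ y∈ h′∈) (*∈ h∈ z′∈) , (begin
    y * y′ - z * z′                  ≈⟨ solve 4 (λ y z y′ z′ → y :* y′ :- z :* z′ := y :* (y′ :- z′) :+ (y :- z) :* z′) refl y z y′ z′ ⟩
    y * (y′ - z′) + (y - z) * z′     ≈⟨ +-cong (*-congˡ e′) (*-congʳ e) ⟩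
    y * (P * h′) + P * h * z′        ≈⟨ solve 5 (λ y P h′ h z′ → y :* (P :* h′) :+ P :* h :* z′ := P :* (y :* h′ :+ h :* z′)) refl y P h′ h z′ ⟩
    P * (y * h′ + h * z′)            ∎)

  ∼-*ʳ : ∀ {y z} w → w ∈ → y ∼ z → y * w ∼ z * w
  ∼-*ʳ {y} {z} w w∈ (h , h∈ , e) = h * w , *∈ h∈ w∈ , (begin
    y * w - z * w   ≈⟨ solve 3 (λ y z w → y :* w :- z :* w := (y :- z) :* w) refl y z w ⟩
    (y - z) * w     ≈⟨ *-congʳ e ⟩
    P * h * w       ≈⟨ *-assoc _ _ _ ⟩
    P * (h * w)     ∎)

  ∼-*ˡ : ∀ {y z} w → w ∈ → y ∼ z → w * y ∼ w * z
  ∼-*ˡ w w∈ y∼z = ∼-trans (∼-reflexive (*-comm _ _)) (∼-trans (∼-*ʳ w w∈ y∼z) (∼-reflexive (*-comm _ _)))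

  ∼-∑ : ∀ n {f g} → (∀ k → f k ∼ g k) → ∑ n f ∼ ∑ n g
  ∼-∑ zero    f∼g = ∼-reflexive refl
  ∼-∑ (suc n) f∼g = ∼-+ (f∼g 0) (∼-∑ n λ k → f∼g (suc k))

-- Reduction of the congruence to the case a = qⁿ.

module Parametric {R : CommutativeRing c ℓ} (S : Subring R i) where
  open CommutativeRing R
  open Subring S
  open Exp commutativeSemiring using (_^_)

  -- Inverses enter as elements `ā`, `q̄` and `s k` of the subring with their defining equations, so
  -- the argument needs no division.
  module Instance
    (a ā q q̄ x : Carrier) (aā≈1 : a * ā ≈ 1#) (qq̄≈1 : q * q̄ ≈ 1#)
    (a∈ : a ∈) (ā∈ : ā ∈) (q∈ : q ∈) (q̄∈ : q̄ ∈) (x∈ : x ∈)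
    (poch : Carrier → ℕ → Carrier)
    (poch-zero : ∀ y → poch y 0 ≈ 1#)
    (poch-suc : ∀ y k → poch y (suc k) ≈ poch y k * (1# - y * (q ^ 2) ^ k))
    (s : ℕ → Carrier) (s∈ : ∀ k → s k ∈) (s-inverse : ∀ k → poch (q ^ 2) k ^ 2 * s k ≈ 1#)
    (N : ℕ) (P : Carrier)
    (P≈ : P ≈ (1# - a * q ^ suc (N ℕ.* 2)) * (a - q ^ suc (N ℕ.* 2)))
    where
    open Exp commutativeSemiring using (^-assocʳ; ^-congʳ)
    open Congruence S P
    open FiniteSums R
    open IntegerSolver R
    open QSeries.Pochhammer R (q ^ 2) poch poch-zero poch-suc
    open SetoidReasoning setoid

    n : ℕ
    n = suc (N ℕ.* 2)

    p : Carrier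
    p = q ^ 2

    open Terminating (q̄ ^ 2) (^-inverse qq̄≈1 2) s
      (λ k → trans (*-comm _ _) (trans (*-congʳ (*-congˡ (sym (*-identityʳ _)))) (s-inverse k))) x N

    p∈ : p ∈
    p∈ = ^∈ q∈ 2

    factor∈ : ∀ {y} → y ∈ → ∀ k → (1# - y * p ^ k) ∈
    factor∈ y∈ k = +∈ 1∈ (-∈ (*∈ y∈ (^∈ p∈ k)))

    poch∈ : ∀ {y} → y ∈ → ∀ k → poch y k ∈
    poch∈ {y} y∈ zero    = resp (sym (poch-zero y)) 1∈
    poch∈ {y} y∈ (suc k) = resp (sym (poch-suc y k)) (*∈ (poch∈ y∈ k) (factor∈ y∈ k))

    b∈ : b ∈
    b∈ = ^∈ p∈ (suc N)

    d∈ : d ∈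
    d∈ = ^∈ (^∈ q̄∈ 2) N

    b≈ : b ≈ q * q ^ n
    b≈ = trans (^-assocʳ q 2 (suc N)) (^-congʳ q (ℕₚ.*-comm 2 (suc N)))

    d≈ : d ≈ q * q̄ ^ n
    d≈ = begin
      (q̄ ^ 2) ^ N                 ≈⟨ trans (^-assocʳ q̄ 2 N) (^-congʳ q̄ (ℕₚ.*-comm 2 N)) ⟩
      q̄ ^ (N ℕ.* 2)               ≈⟨ *-identityˡ _ ⟨
      1# * q̄ ^ (N ℕ.* 2)          ≈⟨ *-congʳ qq̄≈1 ⟨
      q * q̄ * q̄ ^ (N ℕ.* 2)       ≈⟨ *-assoc _ _ _ ⟩
      q * q̄ ^ n                   ∎

    -- a and 1/a enter a factor only through a + 1/a, in which P / a is linear.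
    factor-∼ : ∀ k → (1# - a * q * p ^ k) * (1# - q * ā * p ^ k) ∼ (1# - b * p ^ k) * (1# - d * p ^ k)
    -- With Y = qⁿ and Z = q⁻ⁿ, the difference of the products is q K (Y + Z - a - ā), and P ā Z = Y
    -- + Z - a - ā.
    factor-∼ k = q * K * (ā * Z) , *∈ (*∈ q∈ (^∈ p∈ k)) (*∈ ā∈ (^∈ q̄∈ n)) , (begin
      (1# - a * q * K) * (1# - q * ā * K) - (1# - b * K) * (1# - d * K)
        ≈⟨ +-congˡ (-‿cong (*-cong (+-congˡ (-‿cong (*-congʳ b≈))) (+-congˡ (-‿cong (*-congʳ d≈))))) ⟩
      (1# - a * q * K) * (1# - q * ā * K) - (1# - q * Y * K) * (1# - q * Z * K)
        ≈⟨ solve 6 (λ a ā q K Y Z →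
             (:1 :- a :* q :* K) :* (:1 :- q :* ā :* K) :- (:1 :- q :* Y :* K) :* (:1 :- q :* Z :* K)
             := q :* K :* (Y :+ Z :- a :- ā) :+ q :* q :* K :* K :* (a :* ā :- Y :* Z)) refl a ā q K Y Z ⟩
      q * K * (Y + Z - a - ā) + q * q * K * K * (a * ā - Y * Z)
        ≈⟨ +-congˡ (trans (*-congˡ (trans (+-cong aā≈1 (-‿cong YZ≈1)) (-‿inverseʳ 1#))) (zeroʳ _)) ⟩
      q * K * (Y + Z - a - ā) + 0#
        -- The solver does not use a ā = 1 and Y Z = 1, so ones are placed where these products
        -- occur in the expansion of P ā Z.
        ≈⟨ solve 6 (λ a ā q K Y Z → q :* K :* (Y :+ Z :- a :- ā) :+ con (+ 0)
             := q :* K :* (:1 :* Z :- :1 :* ā :- a :* :1 :* :1 :+ :1 :* Y :* :1)) refl a ā q K Y Z ⟩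
      q * K * (1# * Z - 1# * ā - a * 1# * 1# + 1# * Y * 1#)
        ≈⟨ *-congˡ (+-cong (+-cong (+-cong (*-congʳ aā≈1) (-‿cong (*-congʳ YZ≈1))) (-‿cong (*-cong (*-congˡ aā≈1) YZ≈1))) (*-cong (*-congʳ aā≈1) YZ≈1)) ⟨
      q * K * (a * ā * Z - Y * Z * ā - a * (a * ā) * (Y * Z) + a * ā * Y * (Y * Z))
        ≈⟨ solve 6 (λ a ā q K Y Z → q :* K :* (a :* ā :* Z :- Y :* Z :* ā :- a :* (a :* ā) :* (Y :* Z) :+ a :* ā :* Y :* (Y :* Z))
             := (:1 :- a :* Y) :* (a :- Y) :* (q :* K :* (ā :* Z))) refl a ā q K Y Z ⟩
      (1# - a * Y) * (a - Y) * (q * K * (ā * Z))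
        ≈⟨ *-congʳ P≈ ⟨
      P * (q * K * (ā * Z)) ∎)
      where
      K = p ^ k
      Y = q ^ n
      Z = q̄ ^ n

      YZ≈1 : Y * Z ≈ 1#
      YZ≈1 = ^-inverse qq̄≈1 n

    pochs-∼ : ∀ k → poch (a * q) k * poch (q * ā) k ∼ poch b k * poch d k
    pochs-∼ zero    = ∼-reflexive (*-cong (trans (poch-zero _) (sym (poch-zero _))) (trans (poch-zero _) (sym (poch-zero _))))
    pochs-∼ (suc k) =
      ∼-trans (∼-reflexive (split (a * q) (q * ā)))
      (∼-trans (∼-* (*∈ (poch∈ (*∈ a∈ q∈) k) (poch∈ (*∈ q∈ ā∈) k)) (*∈ (factor∈ b∈ k) (factor∈ d∈ k)) (pochs-∼ k) (factor-∼ k))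
      (∼-reflexive (sym (split b d))))
      where
      split : ∀ y z → poch y (suc k) * poch z (suc k) ≈ poch y k * poch z k * ((1# - y * p ^ k) * (1# - z * p ^ k))
      split y z = trans (*-cong (poch-suc y k) (poch-suc z k))
        (solve 4 (λ u v w z → u :* v :* (w :* z) := u :* w :* (v :* z)) refl _ _ _ _)

    t : ℕ → Carrier
    t k = poch (a * q) k * poch (q * ā) k * s k

    t-∼ : ∀ k → t k ∼ τ k
    t-∼ k = ∼-*ʳ (s k) (s∈ k) (pochs-∼ k)

    -- On the left `t` is replaced by `τ`, the exact identity `terminating` is applied, and on the
    -- right `τ` is turned back into `t`. The n = 2N + 1 terms include every non-zero one because N
    -- < n.
    parametric :
      ∑ n (λ k → t k * x ^ k) ∼ (- 1#) ^ N * q̄ ^ (2 ℕ.* tri (suc N)) * ∑ n (λ k → t k * q ^ (2 ℕ.* k) * poch x k)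
    parametric =
      ∼-trans (∼-∑ n {g = f} λ k → ∼-*ʳ (x ^ k) (^∈ x∈ k) (t-∼ k))
      (∼-trans (∼-reflexive (terminating {n} (s≤s (ℕₚ.m≤m*n N 2))))
      (∼-trans (∼-*ˡ c₀ (*∈ (^∈ (-∈ 1∈) N) (^∈ (^∈ q̄∈ 2) (tri (suc N))))
                 (∼-∑ n {f = g} {g = λ k → t k * q ^ (2 ℕ.* k) * poch x k} λ k → ∼-*ʳ (poch x k) (poch∈ x∈ k)
                   (∼-trans (∼-sym (∼-*ʳ (p ^ k) (^∈ p∈ k) (t-∼ k))) (∼-reflexive (*-congˡ (^-assocʳ q 2 k))))))
      (∼-reflexive (*-congʳ (*-congˡ (^-assocʳ q̄ 2 (tri (suc N))))))))

-- The ring of fractions of an integral domain.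

module FractionField (D : IntegralDomain c ℓ) where
  private module D = IntegralDomain D
  open Fractions D
  open IntegerSolver D.commutativeRing
  open SetoidReasoning D.setoid

  -- If x - y were non-zero, its product with z would be too; deciding whether x - y vanishes makes
  -- this a proof of equality.
  *-cancelʳ : ∀ z {x y} → z D.≉ D.0# → x D.* z D.≈ y D.* z → x D.≈ y
  *-cancelʳ z {x} {y} z≉0 xz≈yz with D.≈0? (x D.- y)
  ... | yes x-y≈0 = begin
    x                  ≈⟨ solve 2 (λ x y → x := (x :- y) :+ y) D.refl x y ⟩
    (x D.- y) D.+ y    ≈⟨ D.+-congʳ x-y≈0 ⟩
    D.0# D.+ y         ≈⟨ D.+-identityˡ y ⟩
    y                  ∎
  ... | no x-y≉0 = contradiction (begin
    (x D.- y) D.* z          ≈⟨ solve 3 (λ x y z → (x :- y) :* z := x :* z :- y :* z) D.refl x y z ⟩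
    x D.* z D.- y D.* z      ≈⟨ D.+-congʳ xz≈yz ⟩
    y D.* z D.- y D.* z      ≈⟨ D.-‿inverseʳ _ ⟩
    D.0#                     ∎) (D.*-nonZero x-y≉0 z≉0)

  -- Multiply by the middle denominator and cancel it. Fractions are explicit arguments because
  -- `_≈_` unfolds to an equation of products from which they cannot be inferred.
  ≈-trans : ∀ f g h → f ≈ g → g ≈ h → f ≈ h
  ≈-trans f g h f≈g g≈h = *-cancelʳ (den g) (den≉0 g) (begin
    num f D.* den h D.* den g      ≈⟨ swap (num f) (den h) (den g) ⟩
    num f D.* den g D.* den h      ≈⟨ D.*-congʳ f≈g ⟩
    num g D.* den f D.* den h      ≈⟨ swap (num g) (den f) (den h) ⟩
    num g D.* den h D.* den f      ≈⟨ D.*-congʳ g≈h ⟩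
    num h D.* den g D.* den f      ≈⟨ swap (num h) (den g) (den f) ⟩
    num h D.* den f D.* den g      ∎)
    where
    swap : ∀ x y z → x D.* y D.* z D.≈ x D.* z D.* y
    swap = solve 3 (λ x y z → x :* y :* z := x :* z :* y) D.refl

  +-cong : ∀ f f′ g g′ → f ≈ f′ → g ≈ g′ → f + g ≈ f′ + g′
  +-cong f f′ g g′ f≈f′ g≈g′ = begin
    (num f D.* den g D.+ num g D.* den f) D.* (den f′ D.* den g′)
      ≈⟨ expand (num f) (den f) (num g) (den g) (den f′) (den g′) ⟩
    num f D.* den f′ D.* (den g D.* den g′) D.+ num g D.* den g′ D.* (den f D.* den f′)
      ≈⟨ D.+-cong (D.*-congʳ f≈f′) (D.*-congʳ g≈g′) ⟩
    num f′ D.* den f D.* (den g D.* den g′) D.+ num g′ D.* den g D.* (den f D.* den f′)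
      ≈⟨ D.+-cong (D.*-congˡ (D.*-comm _ _)) (D.*-congˡ (D.*-comm _ _)) ⟩
    num f′ D.* den f D.* (den g′ D.* den g) D.+ num g′ D.* den g D.* (den f′ D.* den f)
      ≈⟨ expand (num f′) (den f′) (num g′) (den g′) (den f) (den g) ⟨
    (num f′ D.* den g′ D.+ num g′ D.* den f′) D.* (den f D.* den g) ∎
    where
    expand : ∀ u v w y v′ y′ → (u D.* y D.+ w D.* v) D.* (v′ D.* y′) D.≈
                               u D.* v′ D.* (y D.* y′) D.+ w D.* y′ D.* (v D.* v′)
    expand = solve 6 (λ u v w y v′ y′ → (u :* y :+ w :* v) :* (v′ :* y′) :=
                                        u :* v′ :* (y :* y′) :+ w :* y′ :* (v :* v′)) D.refl

  *-cong : ∀ f f′ g g′ → f ≈ f′ → g ≈ g′ → f * g ≈ f′ * g′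
  *-cong f f′ g g′ f≈f′ g≈g′ = begin
    num f D.* num g D.* (den f′ D.* den g′)      ≈⟨ interchange (num f) (num g) (den f′) (den g′) ⟩
    num f D.* den f′ D.* (num g D.* den g′)      ≈⟨ D.*-cong f≈f′ g≈g′ ⟩
    num f′ D.* den f D.* (num g′ D.* den g)      ≈⟨ interchange (num f′) (den f) (num g′) (den g) ⟩
    num f′ D.* num g′ D.* (den f D.* den g)      ∎
    where
    interchange : ∀ u v w y → u D.* v D.* (w D.* y) D.≈ u D.* w D.* (v D.* y)
    interchange = solve 4 (λ u v w y → u :* v :* (w :* y) := u :* w :* (v :* y)) D.refl

  -‿cong : ∀ f g → f ≈ g → - f ≈ - g
  -‿cong f g f≈g = begin
    D.- num f D.* den g        ≈⟨ solve 2 (λ u v → :- u :* v := :- (u :* v)) D.refl (num f) (den g) ⟩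
    D.- (num f D.* den g)      ≈⟨ D.-‿cong f≈g ⟩
    D.- (num g D.* den f)      ≈⟨ solve 2 (λ u v → :- u :* v := :- (u :* v)) D.refl (num g) (den f) ⟨
    D.- num g D.* den f        ∎

  fraction-isCommutativeRing : IsCommutativeRing _≈_ _+_ _*_ -_ 0# 1#
  fraction-isCommutativeRing = record
    { isRing = record
      { +-isAbelianGroup = record
        { isGroup = record
          { isMonoid = record
            { isSemigroup = record
              { isMagma = record
                { isEquivalence = record
                  { refl  = D.refl
                  ; sym   = D.sym
                  ; trans = λ {f} {g} {h} → ≈-trans f g h
                  }
                ; ∙-cong = λ {f} {f′} {g} {g′} → +-cong f f′ g g′
                }
              ; assoc = λ f g h → solve 6 (λ u u′ v v′ w w′ →
                  ((u :* v′ :+ v :* u′) :* w′ :+ w :* (u′ :* v′)) :* (u′ :* (v′ :* w′)) :=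
                  (u :* (v′ :* w′) :+ (v :* w′ :+ w :* v′) :* u′) :* (u′ :* v′ :* w′))
                  D.refl (num f) (den f) (num g) (den g) (num h) (den h)
              }
            ; identity =
                (λ f → solve 2 (λ u u′ → (con (+ 0) :* u′ :+ u :* :1) :* u′ := u :* (:1 :* u′)) D.refl (num f) (den f))
              , (λ f → solve 2 (λ u u′ → (u :* :1 :+ con (+ 0) :* u′) :* u′ := u :* (u′ :* :1)) D.refl (num f) (den f))
            }
          ; inverse =
              (λ f → solve 2 (λ u u′ → (:- u :* u′ :+ u :* u′) :* :1 := con (+ 0) :* (u′ :* u′)) D.refl (num f) (den f))
            , (λ f → solve 2 (λ u u′ → (u :* u′ :+ :- u :* u′) :* :1 := con (+ 0) :* (u′ :* u′)) D.refl (num f) (den f))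
          ; ⁻¹-cong = λ {f} {g} → -‿cong f g
          }
        ; comm = λ f g → solve 4 (λ u u′ v v′ →
            (u :* v′ :+ v :* u′) :* (v′ :* u′) := (v :* u′ :+ u :* v′) :* (u′ :* v′))
            D.refl (num f) (den f) (num g) (den g)
        }
      ; *-cong = λ {f} {f′} {g} {g′} → *-cong f f′ g g′
      ; *-assoc = λ f g h → solve 6 (λ u u′ v v′ w w′ →
          u :* v :* w :* (u′ :* (v′ :* w′)) := u :* (v :* w) :* (u′ :* v′ :* w′))
          D.refl (num f) (den f) (num g) (den g) (num h) (den h)
      ; *-identity =
          (λ f → solve 2 (λ u u′ → :1 :* u :* u′ := u :* (:1 :* u′)) D.refl (num f) (den f))
        , (λ f → solve 2 (λ u u′ → u :* :1 :* u′ := u :* (u′ :* :1)) D.refl (num f) (den f))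
      ; distrib =
          (λ f g h → solve 6 (λ u u′ v v′ w w′ →
            u :* (v :* w′ :+ w :* v′) :* (u′ :* v′ :* (u′ :* w′)) :=
            (u :* v :* (u′ :* w′) :+ u :* w :* (u′ :* v′)) :* (u′ :* (v′ :* w′)))
            D.refl (num f) (den f) (num g) (den g) (num h) (den h))
        , (λ f g h → solve 6 (λ u u′ v v′ w w′ →
            (v :* w′ :+ w :* v′) :* u :* (v′ :* u′ :* (w′ :* u′)) :=
            (v :* u :* (w′ :* u′) :+ w :* u :* (v′ :* u′)) :* (v′ :* w′ :* u′))
            D.refl (num f) (den f) (num g) (den g) (num h) (den h))
      }
    ; *-comm = λ f g → solve 4 (λ u u′ v v′ →
        u :* v :* (v′ :* u′) := v :* u :* (u′ :* v′)) D.refl (num f) (den f) (num g) (den g)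
    }

  fractionRing : CommutativeRing (c ⊔ ℓ) ℓ
  fractionRing = record { isCommutativeRing = fraction-isCommutativeRing }

  ι-cong : ∀ {x y} → x D.≈ y → ι x ≈ ι y
  ι-cong x≈y = D.*-congʳ x≈y

  ι-* : ∀ x y → ι (x D.* y) ≈ ι x * ι y
  ι-* x y = D.*-congˡ (D.*-identityˡ D.1#)

  ι-- : ∀ x y → ι (x D.- y) ≈ ι x - ι y
  ι-- = solve 2 (λ x y → (x :- y) :* (:1 :* :1) := (x :* :1 :+ :- y :* :1) :* :1) D.refl

  inverseʳ : ∀ f → num f D.≉ D.0# → f * f ⁻¹ ≈ 1#
  inverseʳ f num≉0 with D.≈0? (num f)
  ... | yes num≈0 = contradiction num≈0 num≉0
  ... | no  _     = solve 2 (λ u u′ → u :* u′ :* :1 := :1 :* (u′ :* u)) D.refl (num f) (den f)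

-- The modulus and its behaviour under ring homomorphisms.

module Modulus (R : CommutativeRing c ℓ) where
  open CommutativeRing R
  open Exp commutativeSemiring using (_^_)

  modulus : Carrier → Carrier → ℕ → Carrier
  modulus a q n = (1# - a * q ^ n) * (a - q ^ n)

  modulus-cong : ∀ a q n {Q} → q ^ n ≈ Q → modulus a q n ≈ (1# - a * Q) * (a - Q)
  modulus-cong a q n e = *-cong (+-congˡ (-‿cong (*-congˡ e))) (+-congˡ (-‿cong e))

module Homomorphism (R : CommutativeRing c ℓ) (S : CommutativeRing c′ ℓ′) where
  private
    module R = CommutativeRing R
    module S = CommutativeRing S

  module Multiplicative
    (φ : R.Carrier → S.Carrier)
    (φ-1 : φ R.1# S.≈ S.1#)
    (φ-* : ∀ x y → φ (x R.* y) S.≈ φ x S.* φ y)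
    (φ-- : ∀ x y → φ (x R.- y) S.≈ φ x S.- φ y)
    where
    private
      module RExp = Exp R.commutativeSemiring
      module SExp = Exp S.commutativeSemiring

    φ-^ : ∀ x k → φ (x RExp.^ k) S.≈ φ x SExp.^ k
    φ-^ x zero    = φ-1
    φ-^ x (suc k) = S.trans (φ-* _ _) (S.*-congˡ (φ-^ x k))

    φ-1- : ∀ x y → φ (R.1# R.- x R.* y) S.≈ S.1# S.- φ x S.* φ y
    φ-1- x y = S.trans (φ-- _ _) (S.+-cong φ-1 (S.-‿cong (φ-* x y)))

    φ-1-^ : ∀ x m k → φ (R.1# R.- x RExp.^ m R.* (x RExp.^ m) RExp.^ k) S.≈ S.1# S.- φ x SExp.^ m S.* (φ x SExp.^ m) SExp.^ k
    φ-1-^ x m k = S.trans (φ-1- _ _) (S.+-congˡ (S.-‿cong (S.*-cong (φ-^ x m)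
      (S.trans (φ-^ (x RExp.^ m) k) (SExp.^-congˡ k (φ-^ x m))))))

    φ-modulus : ∀ a q n → φ (Modulus.modulus R a q n) S.≈ Modulus.modulus S (φ a) (φ q) n
    φ-modulus a q n = S.trans (φ-* _ _) (S.*-cong
      (S.trans (φ-1- a _) (S.+-congˡ (S.-‿cong (S.*-congˡ (φ-^ q n)))))
      (S.trans (φ-- _ _) (S.+-congˡ (S.-‿cong (φ-^ q n)))))

-- Degrees, and divisors of constant polynomials.

module Degree (K : IntegralDomain c ℓ) where
  open IntegralDomain K
  open PolynomialDomain K
  open SetoidReasoning setoid

  VanishesAbove : ℕ → Poly → Set ℓ
  VanishesAbove m p = ∀ i → m ℕ.< i → coeff p i ≈ 0#

  -- Trailing coefficients may vanish, so the list length does not give the degree; deciding whether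
  -- each tail vanishes finds the last non-zero coefficient.
  degree : ∀ p → ¬ p ≈ₚ 0ₚ → ∃[ m ] coeff p m ≉ 0# × VanishesAbove m p
  degree []      p≉0 = contradiction ≈ₚ-refl p≉0
  degree (x ∷ p) x∷p≉0 with ≈ₚ0? p
  ... | yes p≈0 = 0 , (λ x≈0 → x∷p≉0 (0∷0 x≈0 p≈0)) , λ { (suc i) _ → at p≈0 i }
  ... | no p≉0  = let m , top≉0 , above≈0 = degree p p≉0 in
                  suc m , top≉0 , λ { (suc i) (s≤s m<i) → above≈0 i m<i }

  coeff-*-top : ∀ p r m l → VanishesAbove m p → VanishesAbove l r →
                coeff (p *ₚ r) (m ℕ.+ l) ≈ coeff p m * coeff r l
  coeff-*-top []      r m       l pv rv = sym (zeroˡ _)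
  coeff-*-top (x ∷ p) r zero    l pv rv = begin
    coeff (x · r +ₚ (0# ∷ p *ₚ r)) l           ≈⟨ at (+ₚ-cong (≈ₚ-refl {x · r}) (0∷0 refl (≈0⇒*ₚ≈0 p r (coeffs λ i → pv (suc i) (s≤s z≤n))))) l ⟩
    coeff (x · r +ₚ 0ₚ) l                      ≈⟨ at (+ₚ-identityʳ (x · r)) l ⟩
    coeff (x · r) l                            ≈⟨ coeff-· x r l ⟩
    x * coeff r l                              ∎
  coeff-*-top (x ∷ p) r (suc m) l pv rv = begin
    coeff (x · r +ₚ (0# ∷ p *ₚ r)) (suc (m ℕ.+ l))           ≈⟨ coeff-+ (x · r) (0# ∷ p *ₚ r) (suc (m ℕ.+ l)) ⟩
    coeff (x · r) (suc (m ℕ.+ l)) + coeff (p *ₚ r) (m ℕ.+ l) ≈⟨ +-cong (coeff-· x r _) (coeff-*-top p r m l (λ i m<i → pv (suc i) (s≤s m<i)) rv) ⟩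
    x * coeff r (suc (m ℕ.+ l)) + coeff p m * coeff r l      ≈⟨ +-congʳ (*-congˡ (rv _ (s≤s (ℕₚ.m≤n+m l m)))) ⟩
    x * 0# + coeff p m * coeff r l                           ≈⟨ trans (+-congʳ (zeroʳ x)) (+-identityˡ _) ⟩
    coeff p m * coeff r l                                    ∎

  -- Degrees add over a domain: a factor of positive degree would leave a non-zero coefficient of
  -- the product in positive degree.
  divisor-constant : ∀ {e} → e ≉ 0# → ∀ p r → p *ₚ r ≈ₚ constant e → p ≈ₚ constant (coeff p 0)
  divisor-constant {e} e≉0 p r pr≈e
    with degree p (λ p≈0 → e≉0 (trans (sym (at pr≈e 0)) (at (≈0⇒*ₚ≈0 p r p≈0) 0)))
       | degree r (λ r≈0 → e≉0 (trans (sym (at pr≈e 0)) (at (≈ₚ-trans (*ₚ-comm p r) (≈0⇒*ₚ≈0 r p r≈0)) 0)))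
  ... | zero  , _ , pv | _ = coeffs λ { zero → refl ; (suc i) → pv (suc i) (s≤s z≤n) }
  ... | suc m , pm≉0 , pv | l , rl≉0 , rv =
    contradiction (trans (sym (coeff-*-top p r (suc m) l pv rv)) (at pr≈e (suc (m ℕ.+ l)))) (*-nonZero pm≉0 rl≉0)

  constant-cong : ∀ {x y} → x ≈ y → constant x ≈ₚ constant y
  constant-cong x≈y = ∷-cong x≈y ≈ₚ-refl

  constant-* : ∀ x y → constant (x * y) ≈ₚ constant x *ₚ constant y
  constant-* x y = constant-cong (sym (+-identityʳ _))

  coeff-constant-* : ∀ x p i → coeff (constant x *ₚ p) i ≈ x * coeff p i
  coeff-constant-* x p i = trans (at (+ₚ-cong (≈ₚ-refl {x · p}) (0∷0 refl ≈ₚ-refl)) i)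
    (trans (at (+ₚ-identityʳ (x · p)) i) (coeff-· x p i))

  constant-≉0 : ∀ {x} → x ≉ 0# → ¬ constant x ≈ₚ 0ₚ
  constant-≉0 x≉0 e = x≉0 (at e 0)

  open Homomorphism.Multiplicative commutativeRing polynomialRing constant ≈ₚ-refl constant-* (λ _ _ → ≈ₚ-refl) public
    using () renaming (φ-^ to constant-^)

-- Denominators coprime to the modulus.

module CoprimeToModulus (K : IntegralDomain c ℓ) (q₀ : IntegralDomain.Carrier K)
  (q₀≉0 : IntegralDomain._≉_ K q₀ (IntegralDomain.0# K)) (n : ℕ) where
  private
    module K = IntegralDomain K
    module K[a] = PolynomialDomain K
    module KS = IntegerSolver K.commutativeRing
  open K[a] using (constant; coeff; at)
  open Degree K
  open IntegralDomain K[a].polynomialDomain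
  open Exp commutativeSemiring using (_^_)
  open Exp K.commutativeSemiring using () renaming (_^_ to _^ᴷ_)
  open Modulus commutativeRing
  open IntegerSolver commutativeRing
  open SetoidReasoning setoid

  a q Q P : Carrier
  a = K[a].X
  q = constant q₀
  Q = q ^ n
  P = modulus a q n

  Q₀ : K.Carrier
  Q₀ = q₀ ^ᴷ n

  ^-≉0 : ∀ m → q₀ ^ᴷ m K.≉ K.0#
  ^-≉0 zero    = K.1≉0
  ^-≉0 (suc m) = K.*-nonZero q₀≉0 (^-≉0 m)

  -- The ideal generated by E and P contains a non-zero polynomial free of a.  Unlike
  -- coprimality to P, this is visibly closed under products.
  Good : Carrier → Set (c ⊔ ℓ)
  Good E = ∃[ e ] e K.≉ K.0# × ∃[ u ] ∃[ v ] constant e ≈ u * E + v * P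

  good-constant : ∀ {e} → e K.≉ K.0# → Good (constant e)
  good-constant {e} e≉0 = e , e≉0 , 1# , 0# , solve 2 (λ e P → e := :1 :* e :+ con (+ 0) :* P) refl (constant e) P

  good-* : ∀ {E F} → Good E → Good F → Good (E * F)
  good-* {E} {F} (e , e≉0 , u , v , eq) (f , f≉0 , u′ , v′ , eq′) =
    e K.* f , K.*-nonZero e≉0 f≉0 , u * u′ , u * E * v′ + v * (u′ * F + v′ * P) , (begin
      constant (e K.* f)                          ≈⟨ constant-* e f ⟩
      constant e * constant f                     ≈⟨ *-cong eq eq′ ⟩
      (u * E + v * P) * (u′ * F + v′ * P)
        ≈⟨ solve 7 (λ u v u′ v′ E F P → (u :* E :+ v :* P) :* (u′ :* F :+ v′ :* P) :=
             u :* u′ :* (E :* F) :+ (u :* E :* v′ :+ v :* (u′ :* F :+ v′ :* P)) :* P) refl u v u′ v′ E F P ⟩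
      u * u′ * (E * F) + (u * E * v′ + v * (u′ * F + v′ * P)) * P ∎)

  -- Expanding gives P = -Q + (1 + Q² - Q a) a, so P and a generate Q = qⁿ.
  good-a : Good a
  good-a = Q₀ , ^-≉0 n , 1# + Q * Q - Q * a , - 1# , (begin
    constant Q₀   ≈⟨ constant-^ q₀ n ⟩
    Q             ≈⟨ solve 2 (λ a Q → Q := (:1 :+ Q :* Q :- Q :* a) :* a :+ :- :1 :* ((:1 :- a :* Q) :* (a :- Q))) refl a Q ⟩
    (1# + Q * Q - Q * a) * a + - 1# * P ∎)

  -- With qⁿ written as a single constant polynomial, the coefficients of P compute to expressions
  -- in `Q₀`.
  P≈ : P ≈ (1# - a * constant Q₀) * (a - constant Q₀)
  P≈ = modulus-cong a q n (sym (constant-^ q₀ n))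

  P-coeff₀ : coeff P 0 K.≈ K.- Q₀
  P-coeff₀ = K.trans (at P≈ 0)
    (KS.solve 1 (λ Q → (KS.:1 KS.:- (KS.con (+ 0) KS.:* Q KS.:+ KS.con (+ 0))) KS.:* (KS.con (+ 0) KS.:- Q) KS.:+ KS.con (+ 0) KS.:= KS.:- Q) K.refl Q₀)

  P-coeff₁ : coeff P 1 K.≈ K.1# K.+ Q₀ K.* Q₀
  P-coeff₁ = K.trans (at P≈ 1)
    (KS.solve 1 (λ Q →
      (KS.:1 KS.:- (KS.con (+ 0) KS.:* Q KS.:+ KS.con (+ 0))) KS.:* KS.:1
        KS.:+ (KS.:- (KS.:1 KS.:* Q KS.:+ KS.con (+ 0)) KS.:* (KS.con (+ 0) KS.:- Q) KS.:+ KS.con (+ 0))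
      KS.:= KS.:1 KS.:+ Q KS.:* Q) K.refl Q₀)

  good⇒coprime : ∀ {E} → Good E → Coprime (RawRing.rawSemiring rawRing) E P
  good⇒coprime {E} (e , e≉0 , u , v , eq) {z} (r , rz≈E) (t , tz≈P) =
    -- Here z is free of a and t = P / z, so z t₁ = 1 + Q₀² and z t₀ = -Q₀; the combination (1 +
    -- Q₀²) + Q₀ (-Q₀) = 1 yields the inverse of z.
    constant (t₁ K.+ Q₀ K.* t₀) , (begin
      constant (t₁ K.+ Q₀ K.* t₀) * z               ≈⟨ *-congˡ {constant (t₁ K.+ Q₀ K.* t₀)} z≈z₀ ⟩
      constant (t₁ K.+ Q₀ K.* t₀) * constant z₀     ≈⟨ constant-* _ _ ⟨
      constant ((t₁ K.+ Q₀ K.* t₀) K.* z₀)          ≈⟨ constant-cong bezout ⟩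
      1#                                            ∎)
    where
    z₀ = coeff z 0
    t₀ = coeff t 0
    t₁ = coeff t 1

    z∣e : z * (u * r + v * t) ≈ constant e
    z∣e = begin
      z * (u * r + v * t)            ≈⟨ solve 5 (λ z u r v t → z :* (u :* r :+ v :* t) := u :* (r :* z) :+ v :* (t :* z)) refl z u r v t ⟩
      u * (r * z) + v * (t * z)      ≈⟨ +-cong (*-congˡ {u} rz≈E) (*-congˡ {v} tz≈P) ⟩
      u * E + v * P                  ≈⟨ eq ⟨
      constant e                     ∎

    z≈z₀ : z ≈ constant z₀
    z≈z₀ = divisor-constant e≉0 z (u * r + v * t) z∣e

    P-coeff : ∀ i → z₀ K.* coeff t i K.≈ coeff P i
    P-coeff i = K.trans (K.sym (coeff-constant-* z₀ t i))
      (at (trans (*-congʳ (sym z≈z₀)) (trans (*-comm z t) tz≈P)) i)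

    bezout : (t₁ K.+ Q₀ K.* t₀) K.* z₀ K.≈ K.1#
    bezout = K.trans
      (KS.solve 4 (λ t₁ Q t₀ z → (t₁ KS.:+ Q KS.:* t₀) KS.:* z KS.:= z KS.:* t₁ KS.:+ Q KS.:* (z KS.:* t₀)) K.refl t₁ Q₀ t₀ z₀)
      (K.trans (K.+-cong (K.trans (P-coeff 1) P-coeff₁) (K.*-congˡ (K.trans (P-coeff 0) P-coeff₀)))
        (KS.solve 1 (λ Q → (KS.:1 KS.:+ Q KS.:* Q) KS.:+ Q KS.:* KS.:- Q KS.:= KS.:1) K.refl Q₀))

-- The exponent (1 - n²)/4 as an integer quotient.

square-odd : ∀ N → suc (N ℕ.* 2) ℕ.^ 2 ≡ suc (2 ℕ.* tri (suc N) ℕ.* 4)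
square-odd zero    = ≡.refl
square-odd (suc N) = begin
  suc (suc N ℕ.* 2) ℕ.^ 2
    ≡⟨ solve 1 (λ N → (con 3 :+ N :* con 2) :* ((con 3 :+ N :* con 2) :* con 1)
         := (con 1 :+ N :* con 2) :* ((con 1 :+ N :* con 2) :* con 1) :+ con 8 :* (con 1 :+ N)) ≡.refl N ⟩
  suc (N ℕ.* 2) ℕ.^ 2 ℕ.+ 8 ℕ.* suc N
    ≡⟨ ≡.cong (ℕ._+ 8 ℕ.* suc N) (square-odd N) ⟩
  suc (2 ℕ.* tri (suc N) ℕ.* 4) ℕ.+ 8 ℕ.* suc N
    ≡⟨ solve 2 (λ T N → con 1 :+ con 2 :* T :* con 4 :+ con 8 :* (con 1 :+ N)
         := con 1 :+ con 2 :* (T :+ (con 1 :+ N)) :* con 4) ≡.refl (tri (suc N)) N ⟩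
  suc (2 ℕ.* tri (suc (suc N)) ℕ.* 4) ∎
  where
  open ℕ-Solver.+-*-Solver
  open ≡.≡-Reasoning

1-suc : ∀ k → ℤ.1ℤ ℤ.- + suc k ≡ ℤ.- + k
1-suc zero    = ≡.refl
1-suc (suc k) = ≡.refl

-- Division of a negative integer branches on whether the remainder is zero; rewriting with the zero
-- remainder selects the exact branch.
neg-*-/ℕ : ∀ m d → (ℤ.- + (m ℕ.* suc d)) ℤ./ℕ suc d ≡ ℤ.- + m
neg-*-/ℕ zero    d = ≡.refl
neg-*-/ℕ (suc m) d rewrite ℕ-DivMod.m*n%n≡0 (suc m) (suc d) {{_}} = ≡.cong (λ i → ℤ.- + i) (ℕ-DivMod.m*n/n≡m (suc m) (suc d))

exponent : ∀ N → (ℤ.1ℤ ℤ.- + (suc (N ℕ.* 2) ℕ.^ 2)) ℤ./ + 4 ≡ ℤ.- + (2 ℕ.* tri (suc N))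
exponent N = begin
  (ℤ.1ℤ ℤ.- + (suc (N ℕ.* 2) ℕ.^ 2)) ℤ./ + 4      ≡⟨ ≡.cong (λ i → (ℤ.1ℤ ℤ.- + i) ℤ./ + 4) (square-odd N) ⟩
  (ℤ.1ℤ ℤ.- + suc (M ℕ.* 4)) ℤ./ + 4              ≡⟨ ≡.cong (ℤ._/ + 4) (1-suc (M ℕ.* 4)) ⟩
  (ℤ.- + (M ℕ.* 4)) ℤ./ + 4                       ≡⟨ ℤ-DivMod.div-pos-is-/ℕ (ℤ.- + (M ℕ.* 4)) 4 ⟩
  (ℤ.- + (M ℕ.* 4)) ℤ./ℕ 4                        ≡⟨ neg-*-/ℕ M 3 ⟩
  ℤ.- + M                                         ∎
  where
  open ≡.≡-Reasoning
  M = 2 ℕ.* tri (suc N)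

-- The congruence in the field of fractions of K₀[q][a].

module RationalFunctionCongruence (K₀ : IntegralDomain c ℓ) (x₀ : IntegralDomain.Carrier K₀) where
  private
    module K₀    = IntegralDomain K₀
    module K₀[q] = PolynomialDomain K₀
    module K     = IntegralDomain K₀[q].polynomialDomain
    module K[a]  = PolynomialDomain K₀[q].polynomialDomain
    module A     = IntegralDomain K[a].polynomialDomain

  q₀ : K.Carrier
  q₀ = K₀[q].X

  q₀≉0 : q₀ K.≉ K.0#
  q₀≉0 e = K₀.1≉0 (K₀[q].at e 1)

  -- The constant coefficient in q is 1.
  1-q₀*≉0 : ∀ r → K.1# K.- q₀ K.* r K.≉ K.0#
  1-q₀*≉0 r e = K₀.1≉0 (begin
    K₀.1#                                       ≈⟨ solve 1 (λ y → :1 := :1 :- (con (+ 0) :* y :+ con (+ 0))) K₀.refl (coeff r 0) ⟩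
    K₀.1# K₀.- (K₀.0# K₀.* coeff r 0 K₀.+ K₀.0#)
      ≈⟨ K₀.+-congˡ (K₀.-‿cong (K₀.+-congʳ (coeff-· K₀.0# r 0))) ⟨
    K₀.1# K₀.- (coeff (K₀.0# · r) 0 K₀.+ K₀.0#)
      ≈⟨ K₀.+-congˡ (K₀.-‿cong (coeff-+ (K₀.0# · r) (K₀.0# ∷ (K₀.1# ∷ []) *ₚ r) 0)) ⟨
    K₀.1# K₀.- coeff (q₀ K.* r) 0               ≈⟨ K₀.+-congˡ (coeff-neg (q₀ K.* r) 0) ⟨
    K₀.1# K₀.+ coeff (K.- (q₀ K.* r)) 0         ≈⟨ coeff-+ K.1# (K.- (q₀ K.* r)) 0 ⟨
    coeff (K.1# K.- q₀ K.* r) 0                 ≈⟨ K₀[q].at e 0 ⟩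
    K₀.0#                                       ∎)
    where
    open K₀[q] using (coeff; coeff-+; coeff-neg; coeff-·; _·_; _*ₚ_)
    open IntegerSolver K₀.commutativeRing
    open SetoidReasoning K₀.setoid

  open Fractions K[a].polynomialDomain
  open FractionField K[a].polynomialDomain
  open K[a] using (constant)

  a q x : Fraction
  a = ι K[a].X
  q = ι (constant q₀)
  x = ι (constant (K₀[q].constant x₀))

  t : ℕ → Fraction
  t k = qPochhammer (a * q) (q ^ 2) k * qPochhammer (q / a) (q ^ 2) k / qPochhammer (q ^ 2) (q ^ 2) k ^ 2

  -- The exponent of the sign and the power of q are parameters, so that they can later be rewritten
  -- by propositional equalities.
  Congruent : ℕ → ℕ → Fraction → Set (c ⊔ ℓ)
  Congruent n j f =
    (∑[ k < n ] (t k * x ^ k))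
      ≡ (- 1#) ^ j * f * (∑[ k < n ] (t k * q ^ (2 ℕ.* k) * qPochhammer x (q ^ 2) k))
      [mod Modulus.modulus A.commutativeRing K[a].X (constant q₀) n ]

  module Odd (N : ℕ) where
    n : ℕ
    n = suc (N ℕ.* 2)

    open CoprimeToModulus K₀[q].polynomialDomain q₀ q₀≉0 n using (P; Good; good-*; good-a; good-constant; good⇒coprime)
    open Degree K₀[q].polynomialDomain using (constant-*; constant-≉0)
    open Exp K.commutativeSemiring using () renaming (_^_ to _^ᴷ_)
    private
      module F = CommutativeRing fractionRing
      module Ι = Homomorphism.Multiplicative A.commutativeRing fractionRing ι (F.refl {1#}) ι-* ι--

    -- K[a] localised at the `Good` polynomials. Membership asks for some presentation C / E with E
    -- good, as the stored denominator of a fraction need not be the good one.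
    localisation : Subring fractionRing (c ⊔ ℓ)
    localisation = record
      { _∈   = λ f → ∃[ C ] ∃[ E ] Σ[ E≉0 ∈ E A.≉ A.0# ] Good E × f ≈ mkFraction C E E≉0
      ; resp = λ { {f} {g} f≈g (C , E , E≉0 , good , f≈) → C , E , E≉0 , good , ≈-trans g f (mkFraction C E E≉0) (F.sym {f} {g} f≈g) f≈ }
      ; 1∈   = A.1# , A.1# , A.1≉0 , good-constant K.1≉0 , A.refl
      ; +∈   = λ { {f} {g} (C , E , E≉0 , good , f≈) (C′ , E′ , E′≉0 , good′ , g≈) →
          C A.* E′ A.+ C′ A.* E , E A.* E′ , A.*-nonZero E≉0 E′≉0 , good-* good good′ , +-cong f (mkFraction C E E≉0) g (mkFraction C′ E′ E′≉0) f≈ g≈ }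
      ; *∈   = λ { {f} {g} (C , E , E≉0 , good , f≈) (C′ , E′ , E′≉0 , good′ , g≈) →
          C A.* C′ , E A.* E′ , A.*-nonZero E≉0 E′≉0 , good-* good good′ , *-cong f (mkFraction C E E≉0) g (mkFraction C′ E′ E′≉0) f≈ g≈ }
      ; -∈   = λ { {f} (C , E , E≉0 , good , f≈) → A.- C , E , E≉0 , good , -‿cong f (mkFraction C E E≉0) f≈ }
      }

    open Subring localisation

    ι∈ : ∀ p → ι p ∈
    ι∈ p = p , A.1# , A.1≉0 , good-constant K.1≉0 , A.refl

    num≉0 : ∀ f {E} → E A.≉ A.0# → f ≈ ι E → num f A.≉ A.0#
    num≉0 f {E} E≉0 f≈E num≈0 = A.*-nonZero E≉0 (den≉0 f)
      (A.trans (A.sym f≈E) (A.trans (A.*-congʳ num≈0) (A.zeroˡ A.1#)))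

    -- `_⁻¹` branches on the stored numerator of f, which may differ from E, so that numerator is
    -- first shown to be non-zero; then f⁻¹ equals 1 / E.
    ⁻¹∈ : ∀ f {E} → E A.≉ A.0# → Good E → f ≈ ι E → (f ⁻¹) ∈
    ⁻¹∈ f {E} E≉0 good f≈E with A.≈0? (num f)
    ... | yes num≈0 = contradiction num≈0 (num≉0 f E≉0 f≈E)
    ... | no  _     = A.1# , E , E≉0 , good ,
      A.trans (A.*-comm (den f) E) (A.trans (A.sym f≈E) (A.*-comm (num f) A.1#))

    X≉0 : K[a].X A.≉ A.0#
    X≉0 e = K.1≉0 (K[a].at e 1)

    -- f is a non-zero polynomial free of a.
    NonZeroConstant : Fraction → Set _
    NonZeroConstant f = ∃[ e ] e K.≉ K.0# × f ≈ ι (constant e)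

    κ-* : ∀ e e′ → ι (constant (e K.* e′)) ≈ ι (constant e) * ι (constant e′)
    κ-* e e′ = ≈-trans (ι (constant (e K.* e′))) (ι (constant e A.* constant e′)) (ι (constant e) * ι (constant e′))
      (ι-cong (constant-* e e′)) (ι-* (constant e) (constant e′))

    private
      module Κ = Homomorphism.Multiplicative K.commutativeRing fractionRing (λ e → ι (constant e)) (F.refl {1#}) κ-* (λ e e′ → ι-- (constant e) (constant e′))

    nzc-* : ∀ f g → NonZeroConstant f → NonZeroConstant g → NonZeroConstant (f * g)
    nzc-* f g (e , e≉0 , f≈) (e′ , e′≉0 , g≈) = e K.* e′ , K.*-nonZero e≉0 e′≉0 , (begin
      f * g                                  ≈⟨ *-cong f (ι (constant e)) g (ι (constant e′)) f≈ g≈ ⟩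
      ι (constant e) * ι (constant e′)       ≈⟨ κ-* e e′ ⟨
      ι (constant (e K.* e′))                ∎)
      where open SetoidReasoning F.setoid

    nzc-1- : ∀ k → NonZeroConstant (1# - q ^ 2 * (q ^ 2) ^ k)
    nzc-1- k = e , e≉0 , F.sym {ι (constant e)} {1# - q ^ 2 * (q ^ 2) ^ k} (Κ.φ-1-^ q₀ 2 k)
      where
      -- One factor q is split off from q², leaving the shape 1 - q r required by `1-q₀*≉0`.
      r = q₀ ^ᴷ 1 K.* (q₀ ^ᴷ 2) ^ᴷ k
      e = K.1# K.- q₀ ^ᴷ 2 K.* (q₀ ^ᴷ 2) ^ᴷ k

      e≉0 : e K.≉ K.0#
      e≉0 e≈0 = 1-q₀*≉0 r (K.trans (K.+-congˡ {K.1#} (K.-‿cong (K.sym (K.*-assoc q₀ (q₀ ^ᴷ 1) ((q₀ ^ᴷ 2) ^ᴷ k))))) e≈0)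

    nzc-poch : ∀ k → NonZeroConstant (qPochhammer (q ^ 2) (q ^ 2) k)
    nzc-poch zero    = K.1# , K.1≉0 , A.refl
    nzc-poch (suc k) = nzc-* (qPochhammer (q ^ 2) (q ^ 2) k) (1# - q ^ 2 * (q ^ 2) ^ k) (nzc-poch k) (nzc-1- k)

    nzc-poch² : ∀ k → NonZeroConstant (qPochhammer (q ^ 2) (q ^ 2) k ^ 2)
    nzc-poch² k = nzc-* f (f * 1#) (nzc-poch k) (nzc-* f 1# (nzc-poch k) (K.1# , K.1≉0 , A.refl))
      where f = qPochhammer (q ^ 2) (q ^ 2) k

    nzc-⁻¹∈ : ∀ f → NonZeroConstant f → (f ⁻¹) ∈
    nzc-⁻¹∈ f (e , e≉0 , f≈e) = ⁻¹∈ f (constant-≉0 {e} e≉0) (good-constant e≉0) f≈e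

    nzc-inverseʳ : ∀ f → NonZeroConstant f → f * f ⁻¹ ≈ 1#
    nzc-inverseʳ f (e , e≉0 , f≈e) = inverseʳ f (num≉0 f (constant-≉0 {e} e≉0) f≈e)

    nzc-q : NonZeroConstant q
    nzc-q = q₀ , q₀≉0 , A.refl

    open Parametric.Instance localisation a (a ⁻¹) q (q ⁻¹) x
      (inverseʳ a X≉0) (nzc-inverseʳ q nzc-q)
      (ι∈ K[a].X) (⁻¹∈ a X≉0 good-a A.refl) (ι∈ (constant q₀)) (nzc-⁻¹∈ q nzc-q) (ι∈ (constant (K₀[q].constant x₀)))
      (λ y k → qPochhammer y (q ^ 2) k) (λ y → A.refl) (λ y k → A.refl)
      (λ k → (qPochhammer (q ^ 2) (q ^ 2) k ^ 2) ⁻¹)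
      (λ k → nzc-⁻¹∈ (qPochhammer (q ^ 2) (q ^ 2) k ^ 2) (nzc-poch² k))
      (λ k → nzc-inverseʳ (qPochhammer (q ^ 2) (q ^ 2) k ^ 2) (nzc-poch² k))
      N (ι P) (Ι.φ-modulus K[a].X (constant q₀) n)
      using (parametric)
    open Congruence localisation (ι P) using (_∼_)

    -- A quotient in the localisation has a good denominator, which is therefore coprime to P.
    ∼⇒≡[mod] : ∀ f g → f ∼ g → f ≡ g [mod P ]
    ∼⇒≡[mod] f g (h , (C , E , E≉0 , good , h≈) , f-g≈) =
      C , E , E≉0 , good⇒coprime good ,
      ≈-trans (f - g) (ι P * h) (ι P * mkFraction C E E≉0) f-g≈
        (*-cong (ι P) (ι P) h (mkFraction C E E≉0) A.refl h≈)

    congruence : Congruent n N ((q ⁻¹) ^ (2 ℕ.* tri (suc N)))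
    congruence = ∼⇒≡[mod]
      (∑[ k < n ] (t k * x ^ k))
      ((- 1#) ^ N * (q ⁻¹) ^ (2 ℕ.* tri (suc N)) * (∑[ k < n ] (t k * q ^ (2 ℕ.* k) * qPochhammer x (q ^ 2) k)))
      parametric

  ^ᶻ-neg : ∀ f m → f ^ᶻ (ℤ.- + m) ≡ (f ⁻¹) ^ m
  ^ᶻ-neg f zero    = ≡.refl
  ^ᶻ-neg f (suc m) = ≡.refl

  odd-congruence : ∀ N n → n ≡ suc (N ℕ.* 2) →
    Congruent n ((n ∸ 1) ℕ./ 2) (q ^ᶻ ((ℤ.1ℤ ℤ.- + (n ℕ.^ 2)) ℤ./ + 4))
  odd-congruence N n ≡.refl = ≡.subst₂ (Congruent n)
    (≡.sym (ℕ-DivMod.m*n/n≡m N 2))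
    (≡.sym (≡.trans (≡.cong (q ^ᶻ_) (exponent N)) (^ᶻ-neg q (2 ℕ.* tri (suc N)))))
    (Odd.congruence N)

theorem4p2 : (n : ℕ) → 0 ℕ.< n → n ℕ.% 2 ≡ 1 →
  let P = let open Polynomials in (1# - a * q ^ n) * (a - q ^ n)
      open RationalFunctions
      t = λ k → qPochhammer (a * q) (q ^ 2) k * qPochhammer (q / a) (q ^ 2) k / qPochhammer (q ^ 2) (q ^ 2) k ^ 2
  in  (∑[ k < n ] (t k * x ^ k))
        ≡ (- 1#) ^ ((n ℕ.∸ 1) ℕ./ 2) * q ^ᶻ ((ℤ.1ℤ ℤ.- ℤ.+ (n ℕ.^ 2)) ℤ./ ℤ.+ 4)
            * (∑[ k < n ] (t k * q ^ (2 ℕ.* k) * qPochhammer x (q ^ 2) k))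
        [mod P ]
theorem4p2 n 0<n n%2≡1 =
  -- Taking K₀ = ℤ[x] and x₀ = x recovers the tower ((ℤ[x])[q])[a]. For odd n, N = n / 2 satisfies n
  -- = 1 + 2N.
  RationalFunctionCongruence.odd-congruence Polynomials.ℤ[x].polynomialDomain Polynomials.ℤ[x].X (n ℕ./ 2) n
    (≡.trans (ℕ-DivMod.m≡m%n+[m/n]*n n 2) (≡.cong (ℕ._+ n ℕ./ 2 ℕ.* 2) n%2≡1))
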